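{- Let $\mathit{pw}(n)$ be a function of $n$ and let $\mathcal{G}$ be the family of (connected) graphs of pathwidth at most $\mathit{pw}(n)$. Let $\delta_{\mathcal{G}}(n)=\max\{\delta(\mathcal{A}(G)) : G\in\mathcal{G},\ |V(G)|=n\}$. Then $$\Omega(\mathit{pw}(n)\cdot n)\le \delta_{\mathcal{G}}(n)\le O(\mathit{pw}(n)\cdot n\log n).$$
   Context: All graphs are finite, simple and connected. For a graph $G=(V,E)$, a search tree on $G$ is a rooted tree with vertex set $V$ defined recursively: its root is some vertex $r\in V$, and $r$ is joined to the roots of search trees on each connected component of $G-r$. The tubes of a search tree are the vertex sets of its subtrees. Two search trees on $G$ are related by a rotation if their sets of tubes have symmetric difference of size exactly two. The graph associahedron $\mathcal{A}(G)$ is a polytope whose skeleton is isomorphic to the graph on search trees of $G$ with adjacency given by rotations; $\delta(\mathcal{A}(G))$ is the diameter of this graph. Pathwidth is the usual graph parameter (one less than the smallest clique number of an interval supergraph of $G$).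
   Formalization: The formal statement assumes 1 ≤ pw(n) ≤ n−1 for all n ≥ 2: with pw(n)=0 the family is empty and the maximum undefined, and for pw(n) growing faster than n (e.g. n³) the lower bound fails, since all diameters are O(n²). -}

module Defs where

open import Data.Nat using (ℕ; zero; suc; _≤_; _<_; _*_)
open import Data.Bool using (Bool; true; false)
open import Data.Fin using (Fin)
open import Data.Fin.Subset using (Subset; _∈_; _∉_; _⊆_; _─_; ⁅_⁆; ⊤; ∣_∣; Nonempty)
open import Data.List using (List; []; _∷_)
open import Data.List.Relation.Unary.All using (All; []; _∷_)
open import Data.List.Relation.Unary.Unique.Propositional using (Unique)
open import Data.List.Membership.Propositional using () renaming (_∈_ to _∈ₗ_)
open import Data.Product using (Σ; ∃; _×_; _,_)
open import Data.Sum using (_⊎_)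
open import Data.Empty using (⊥)
open import Relation.Nullary using (¬_)
open import Relation.Binary.PropositionalEquality using (_≡_; _≢_)

record Graph (n : ℕ) : Set where
  field
    adj  : Fin n → Fin n → Bool
    sym  : ∀ u v → adj u v ≡ adj v u
    irr  : ∀ v → adj v v ≡ false
open Graph public

module _ {n : ℕ} (G : Graph n) where

  data Walk (S : Subset n) : Fin n → Fin n → Set where
    here : ∀ {u} → u ∈ S → Walk S u u
    step : ∀ {u w v} → u ∈ S → adj G u w ≡ true → Walk S w v → Walk S u v

  ConnectedOn : Subset n → Set
  ConnectedOn S = ∀ u v → u ∈ S → v ∈ S → Walk S u v

  Connected : Set
  Connected = ConnectedOn ⊤

  IsComponent : Subset n → Subset n → Set
  IsComponent T C =
    C ⊆ T × Nonempty C × ConnectedOn C ×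
    (∀ u v → u ∈ C → v ∈ T → v ∉ C → adj G u v ≡ false)

  data ST : Subset n → Set where
    node : ∀ {S} (r : Fin n) → r ∈ S
         → (cs : List (Subset n))
         → All (IsComponent (S ─ ⁅ r ⁆)) cs
         → (∀ C → IsComponent (S ─ ⁅ r ⁆) C → C ∈ₗ cs)
         → Unique cs
         → All ST cs
         → ST S

  SearchTree : Set
  SearchTree = ST ⊤

  mutual
    IsTube : ∀ {S} → ST S → Subset n → Set
    IsTube {S} (node _ _ _ _ _ _ ts) X = X ≡ S ⊎ IsTubeAll ts X

    IsTubeAll : ∀ {cs} → All ST cs → Subset n → Set
    IsTubeAll []       X = ⊥
    IsTubeAll (t ∷ ts) X = IsTube t X ⊎ IsTubeAll ts X

  InSymDiff : SearchTree → SearchTree → Subset n → Set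
  InSymDiff T U X = (IsTube T X × ¬ IsTube U X) ⊎ (IsTube U X × ¬ IsTube T X)

  Rotation : SearchTree → SearchTree → Set
  Rotation T U = ∃ λ A → ∃ λ B → A ≢ B × InSymDiff T U A × InSymDiff T U B ×
                 (∀ X → InSymDiff T U X → X ≡ A ⊎ X ≡ B)

  -- search trees are identified by their sets of tubes
  SameTubes : SearchTree → SearchTree → Set
  SameTubes T U = ∀ X → (IsTube T X → IsTube U X) × (IsTube U X → IsTube T X)

  -- a path of exactly k rotations from T to (a tree with the same tubes as) U
  -- in the skeleton of the graph associahedron A(G)
  data RotPath : SearchTree → SearchTree → ℕ → Set where
    stop : ∀ {T U} → SameTubes T U → RotPath T U zero
    step : ∀ {T V U k} → Rotation T V → RotPath V U k → RotPath T U (suc k)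

  DiamLe : ℕ → Set
  DiamLe m = ∀ T U → ∃ λ k → RotPath T U k × k ≤ m

  -- pathwidth(G) ≤ p: there is an interval supergraph of G (on the same
  -- vertex set, given by closed intervals [a v , b v]) of clique number ≤ p + 1
  Overlap : (Fin n → ℕ) → (Fin n → ℕ) → Fin n → Fin n → Set
  Overlap a b u v = ∃ λ x → (a u ≤ x × x ≤ b u) × (a v ≤ x × x ≤ b v)

  PathwidthLe : ℕ → Set
  PathwidthLe p = ∃ λ (a : Fin n → ℕ) → ∃ λ (b : Fin n → ℕ) →
    (∀ v → a v ≤ b v) ×
    (∀ u v → adj G u v ≡ true → Overlap a b u v) ×
    (∀ (K : Subset n) → (∀ u v → u ∈ K → v ∈ K → u ≢ v → Overlap a b u v)
                      → ∣ K ∣ ≤ suc p)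

  InFamily : ℕ → Set
  InFamily p = Connected × PathwidthLe p

{-# OPTIONS --safe #-}
module Submission where

-- Every search tree comes from an order in which the vertices are removed, and
-- exchanging two consecutive vertices of such an order either leaves the tubes
-- unchanged or is a rotation.
--
-- Upper bound: sorting an order into the order of a tree T₀ takes at most as many
-- rotations as the sum of the sizes of the tubes of T₀.  An interval supergraph of
-- clique number p + 1 has a clique whose removal leaves no component with more than half
-- of the vertices; iterating gives a T₀ with that sum at most (p + 1) n (1 + log n).
--
-- Lower bound: a rotation reverses the relative order of the end points of at most
-- one edge, so a tree and its reversal are at distance at least the number of edges.
-- The join of a clique on p vertices with an independent set has pathwidth at most p
-- and at least p n / 2 edges.

open import Defs
open import Data.Nat using (ℕ; zero; suc; _+_; _*_; _^_; _⊔_; _≤_; _<_; z≤n; s≤s; s≤s⁻¹; _<?_; _≤?_)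
open import Data.Nat.Logarithm using (⌊log₂_⌋; ⌊log₂⌋-mono-≤; ⌊log₂[2^n]⌋≡n)
import Data.Nat.Properties as ℕ
open import Data.Nat.Solver using (module +-*-Solver)
open +-*-Solver using (solve; _:*_; _:+_; _:=_) renaming (con to κ)
open import Data.Bool using (true; false)
import Data.Bool.Properties as Bool
open import Data.Fin using (Fin; toℕ; _≟_)
open import Data.Fin.Properties using (any?; toℕ<n; toℕ-injective)
open import Data.Fin.Subset using (Subset; _∈_; _∉_; _⊆_; _─_; _-_; ⁅_⁆; ⊤; ∣_∣; Nonempty; inside; outside)
open import Data.Fin.Subset.Properties
  using (_∈?_; ⊆-antisym; p─⊥≡p; Empty-unique; ∣⊥∣≡0; x∈p⇒∣p-x∣<∣p∣; x∈p∧x≢y⇒x∈p-y; p─q⊆p; x∈⁅x⁆; ∈⊤)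
open import Data.List using (List; []; _∷_; _++_; length; map; filter; deduplicate; reverse; take; allFin)
open import Data.List.Relation.Unary.All as All using (All; []; _∷_)
import Data.List.Relation.Unary.All.Properties as AllProps
open import Data.List.Relation.Unary.Any using (here; there)
open import Data.List.Relation.Unary.AllPairs as AllPairs using ([]; _∷_)
open import Data.List.Relation.Unary.Unique.Propositional using (Unique)
import Data.List.Relation.Unary.Unique.Propositional.Properties as Unique
import Data.List.Relation.Unary.Unique.DecPropositional.Properties as DecUnique
open import Data.List.Membership.Propositional using () renaming (_∈_ to _∈ₗ_; _∉_ to _∉ₗ_)
open import Data.List.Membership.Propositional.Properties
  using (∈-++⁺ˡ; ∈-++⁺ʳ; ∈-++⁻; ∈-map⁺; ∈-map⁻; ∈-filter⁺; ∈-filter⁻;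
         ∈-deduplicate⁺; ∈-deduplicate⁻; ∈-∃++; ∈-allFin)
open import Data.List.Properties
  using (length-++; length-tabulate; length-map; length-take; length-filter; unfold-reverse; filter-none;
         filter-accept)
open import Data.Vec using ([]; _∷_; there; tabulate)
import Data.Vec.Properties as Vec
open import Data.Product using (Σ; ∃; _×_; _,_; proj₁; proj₂)
open import Data.Sum as Sum using (_⊎_; inj₁; inj₂; [_,_]′; map₂; swap)
open import Data.Empty using (⊥)
open import Function using (_∘_; id; case_of_; mk⇔)
open import Relation.Nullary using (¬_; Dec; yes; no; does; _×-dec_; _⊎-dec_; ¬?; contradiction)
open import Relation.Nullary.Decidable using (map′; dec-true; dec-false; does-⇔)
open import Relation.Unary using (Decidable)
open import Relation.Binary.Definitions using (DecidableEquality)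
open import Relation.Binary.PropositionalEquality as ≡ using (_≡_; _≢_; refl; cong; subst)
import Data.List.Membership.DecPropositional as DecMembership
open import Data.List.Relation.Binary.Permutation.Propositional as Perm using (_↭_; ↭-sym; ↭⇒↭ₛ)
open import Data.List.Relation.Binary.Permutation.Propositional.Properties
  using (∈-resp-↭; shift; drop-mid; ↭-empty-inv; ↭-length; ++⁺; ++⁺ˡ; ↭-reverse)
import Data.List.Relation.Binary.Permutation.Setoid.Properties as SetoidPerm

-- Subsets of `Fin n` and duplicate-free lists

private
  variable
    n : ℕ

x∈p─q⇒x∉q : ∀ (p q : Subset n) {x} → x ∈ p ─ q → x ∉ q
x∈p─q⇒x∉q (_ ∷ p) (inside  ∷ q) (there h) (there h′) = x∈p─q⇒x∉q p q h h′
x∈p─q⇒x∉q (_ ∷ p) (outside ∷ q) (there h) (there h′) = x∈p─q⇒x∉q p q h h′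

x∈p-y⇒x≢y : ∀ (p : Subset n) {x y} → x ∈ p - y → x ≢ y
x∈p-y⇒x≢y p {x} h refl = x∈p─q⇒x∉q p ⁅ x ⁆ h (x∈⁅x⁆ x)

module _ {P : Fin n → Set} (P? : Decidable P) where abstract

  comprehension : Subset n
  comprehension = tabulate (λ v → does (P? v))

  comprehension⁺ : ∀ {v} → P v → v ∈ comprehension
  comprehension⁺ {v} pv = Vec.lookup⇒[]= v comprehension
    (≡.trans (Vec.lookup∘tabulate _ v) (dec-true (P? v) pv))

  comprehension⁻ : ∀ {v} → v ∈ comprehension → P v
  comprehension⁻ {v} h
    with P? v | ≡.trans (≡.sym (Vec.lookup∘tabulate (λ w → does (P? w)) v)) (Vec.[]=⇒lookup h)
  ... | yes pv | _ = pv
  ... | no  _  | ()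

infix 4 _∈ₗ?_
_∈ₗ?_ : (v : Fin n) (l : List (Fin n)) → Dec (v ∈ₗ l)
_∈ₗ?_ = DecMembership._∈?_ _≟_

abstract
  set : List (Fin n) → Subset n
  set l = comprehension (_∈ₗ? l)

  set⁺ : ∀ {l : List (Fin n)} {v} → v ∈ₗ l → v ∈ set l
  set⁺ {l = l} = comprehension⁺ (_∈ₗ? l)

  set⁻ : ∀ {l : List (Fin n)} {v} → v ∈ set l → v ∈ₗ l
  set⁻ {l = l} = comprehension⁻ (_∈ₗ? l)

set-mono : ∀ {l l′ : List (Fin n)} → (∀ {v} → v ∈ₗ l → v ∈ₗ l′) → set l ⊆ set l′
set-mono f = set⁺ ∘ f ∘ set⁻

set-there : ∀ {v} {l : List (Fin n)} → set l ⊆ set (v ∷ l)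
set-there = set-mono there

set-↭ : ∀ {l l′ : List (Fin n)} → l ↭ l′ → set l ≡ set l′
set-↭ p = ⊆-antisym (set-mono (∈-resp-↭ p)) (set-mono (∈-resp-↭ (↭-sym p)))

Unique-↭ : ∀ {l l′ : List (Fin n)} → l ↭ l′ → Unique l → Unique l′
Unique-↭ p = SetoidPerm.Unique-resp-↭ (≡.setoid _) (↭⇒↭ₛ p)

Unique-++⁻ˡ : ∀ (xs : List (Fin n)) {ys} → Unique (xs ++ ys) → Unique xs
Unique-++⁻ˡ []       _          = []
Unique-++⁻ˡ (x ∷ xs) (x≢ ∷ l!) = AllProps.++⁻ˡ xs x≢ ∷ Unique-++⁻ˡ xs l!

unique-⊆⇒length≤ : ∀ {A : Set} {xs ys : List A} → Unique xs → (∀ {v} → v ∈ₗ xs → v ∈ₗ ys) →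
                   length xs ≤ length ys
unique-⊆⇒length≤ {xs = []}     _         _ = z≤n
unique-⊆⇒length≤ {xs = x ∷ xs} (x≢ ∷ xs!) f with ∈-∃++ (f (here refl))
... | as , bs , refl = ℕ.≤-trans
  (s≤s (unique-⊆⇒length≤ xs! λ v∈xs →
    case ∈-resp-↭ (shift x as bs) (f (there v∈xs)) of λ where
      (here refl) → contradiction refl (All.lookup x≢ v∈xs)
      (there h)   → h))
  (ℕ.≤-reflexive (≡.sym (↭-length (shift x as bs))))

unique⇒↭ : ∀ {xs ys : List (Fin n)} → Unique xs → Unique ys →
           (∀ {v} → v ∈ₗ xs → v ∈ₗ ys) → (∀ {v} → v ∈ₗ ys → v ∈ₗ xs) → xs ↭ ys
unique⇒↭ {xs = []} {[]}    _ _ _ _ = Perm.refl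
unique⇒↭ {xs = []} {_ ∷ _} _ _ _ g = case g (here refl) of λ ()
unique⇒↭ {xs = x ∷ xs} (x≢ ∷ xs!) ys! f g with ∈-∃++ (f (here refl))
... | as , bs , refl = Perm.trans (Perm.prep x (unique⇒↭ xs! (AllPairs.tail ys!′) f′ g′)) (↭-sym σ)
  where
  σ = shift x as bs
  ys!′ = Unique-↭ σ ys!
  f′ : ∀ {v} → v ∈ₗ xs → v ∈ₗ as ++ bs
  f′ h with ∈-resp-↭ σ (f (there h))
  ... | here refl = contradiction refl (All.lookup x≢ h)
  ... | there h′  = h′
  g′ : ∀ {v} → v ∈ₗ as ++ bs → v ∈ₗ xs
  g′ h with g (∈-resp-↭ (↭-sym σ) (there h))
  ... | here refl = contradiction h (Unique.Unique[x∷xs]⇒x∉xs ys!′)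
  ... | there h′  = h′

unique-⊆⇒length≤∣∣ : ∀ {xs : List (Fin n)} {X} → Unique xs → (∀ {v} → v ∈ₗ xs → v ∈ X) →
                     length xs ≤ ∣ X ∣
unique-⊆⇒length≤∣∣ {xs = []}         _          _ = z≤n
unique-⊆⇒length≤∣∣ {xs = x ∷ xs} {X} (x≢ ∷ xs!) f = ℕ.≤-trans
  (s≤s (unique-⊆⇒length≤∣∣ {X = X - x} xs! λ h →
    x∈p∧x≢y⇒x∈p-y (f (there h)) λ { refl → All.lookup x≢ h refl }))
  (x∈p⇒∣p-x∣<∣p∣ (f (here refl)))

∣p∣≤1+∣p-x∣ : ∀ (p : Subset n) x → ∣ p ∣ ≤ suc ∣ p - x ∣
∣p∣≤1+∣p-x∣ (inside  ∷ p) Fin.zero    = s≤s (ℕ.≤-reflexive (cong ∣_∣ (≡.sym (p─⊥≡p p))))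
∣p∣≤1+∣p-x∣ (outside ∷ p) Fin.zero    = ℕ.m≤n⇒m≤1+n (ℕ.≤-reflexive (cong ∣_∣ (≡.sym (p─⊥≡p p))))
∣p∣≤1+∣p-x∣ (inside  ∷ p) (Fin.suc x) = s≤s (∣p∣≤1+∣p-x∣ p x)
∣p∣≤1+∣p-x∣ (outside ∷ p) (Fin.suc x) = ∣p∣≤1+∣p-x∣ p x

⊆⇒∣∣≤length : ∀ (l : List (Fin n)) {X} → (∀ {v} → v ∈ X → v ∈ₗ l) → ∣ X ∣ ≤ length l
⊆⇒∣∣≤length {n} [] f = ℕ.≤-reflexive
  (≡.trans (cong ∣_∣ (Empty-unique λ (v , v∈) → case f v∈ of λ ())) (∣⊥∣≡0 n))
⊆⇒∣∣≤length (x ∷ l) {X} f = ℕ.≤-trans (∣p∣≤1+∣p-x∣ X x) (s≤s (⊆⇒∣∣≤length l λ v∈ →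
  case f (p─q⊆p X ⁅ x ⁆ v∈) of λ where
    (here v≡x) → contradiction v≡x (x∈p-y⇒x≢y X v∈)
    (there h)  → h))

-- Relative order in a list

data Precedes {A : Set} (x y : A) : List A → Set where
  here  : ∀ {l} → y ∈ₗ l → Precedes x y (x ∷ l)
  there : ∀ {z l} → Precedes x y l → Precedes x y (z ∷ l)

module _ {A : Set} {x y : A} where

  Precedes⇒∈ˡ : ∀ {l} → Precedes x y l → x ∈ₗ l
  Precedes⇒∈ˡ (here _)  = here refl
  Precedes⇒∈ˡ (there p) = there (Precedes⇒∈ˡ p)

  Precedes⇒∈ʳ : ∀ {l} → Precedes x y l → y ∈ₗ l
  Precedes⇒∈ʳ (here h)  = there h
  Precedes⇒∈ʳ (there p) = there (Precedes⇒∈ʳ p)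

  Precedes-total : ∀ {l} → x ≢ y → x ∈ₗ l → y ∈ₗ l → Precedes x y l ⊎ Precedes y x l
  Precedes-total x≢y (here refl) (here refl) = contradiction refl x≢y
  Precedes-total x≢y (here refl) (there y∈)  = inj₁ (here y∈)
  Precedes-total x≢y (there x∈)  (here refl) = inj₂ (here x∈)
  Precedes-total x≢y (there x∈)  (there y∈)  = Sum.map there there (Precedes-total x≢y x∈ y∈)

  Precedes-++ : ∀ as {bs} → x ∈ₗ as → y ∈ₗ bs → Precedes x y (as ++ bs)
  Precedes-++ (_ ∷ as) (here refl) y∈ = here (∈-++⁺ʳ as y∈)
  Precedes-++ (_ ∷ as) (there x∈)  y∈ = there (Precedes-++ as x∈ y∈)

  Precedes-++⁺ˡ : ∀ {as bs} → Precedes x y as → Precedes x y (as ++ bs)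
  Precedes-++⁺ˡ (here h)  = here (∈-++⁺ˡ h)
  Precedes-++⁺ˡ (there p) = there (Precedes-++⁺ˡ p)

Precedes⇒≢ : ∀ {A : Set} {x y : A} {l} → Unique l → Precedes x y l → x ≢ y
Precedes⇒≢ (x≢ ∷ _) (here y∈) = All.lookup x≢ y∈
Precedes⇒≢ (_ ∷ l!) (there p) = Precedes⇒≢ l! p

Precedes-reverse : ∀ {A : Set} {x y : A} {l} → Precedes x y l → Precedes y x (reverse l)
Precedes-reverse {x = x} {y} (here {l} h) = subst (Precedes y x) (≡.sym (unfold-reverse x l))
  (Precedes-++ (reverse l) (∈-resp-↭ (↭-sym (↭-reverse l)) h) (here refl))
Precedes-reverse {x = x} {y} (there {z} {l} p) = subst (Precedes y x) (≡.sym (unfold-reverse z l))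
  (Precedes-++⁺ˡ (Precedes-reverse p))

-- With all vertices as the list, these are the edges of the join of a clique on the first `p`
-- vertices with an independent set, each once and directed from its earlier end point.
pairs : {A : Set} → ℕ → List A → List (A × A)
pairs zero    _       = []
pairs (suc p) []      = []
pairs (suc p) (x ∷ l) = map (x ,_) l ++ pairs p l

module _ {A : Set} where

  pairs⇒take : ∀ p {l : List A} {x y} → (x , y) ∈ₗ pairs p l → x ∈ₗ take p l
  pairs⇒take (suc p) {z ∷ l} h with ∈-++⁻ (map (z ,_) l) h
  ... | inj₂ h′ = there (pairs⇒take p h′)
  ... | inj₁ h′ with ∈-map⁻ (z ,_) h′
  ...   | _ , _ , refl = here refl

  pairs⇒Precedes : ∀ p {l : List A} {x y} → (x , y) ∈ₗ pairs p l → Precedes x y l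
  pairs⇒Precedes (suc p) {z ∷ l} h with ∈-++⁻ (map (z ,_) l) h
  ... | inj₂ h′ = there (pairs⇒Precedes p h′)
  ... | inj₁ h′ with ∈-map⁻ (z ,_) h′
  ...   | _ , y∈l , refl = here y∈l

  pairs-unique : ∀ p {l : List A} → Unique l → Unique (pairs p l)
  pairs-unique zero    _  = []
  pairs-unique (suc p) [] = []
  pairs-unique (suc p) {z ∷ l} l!@(_ ∷ l!′) = Unique.++⁺
    (Unique.map⁺ (cong proj₂) l!′) (pairs-unique p l!′)
    λ (h , k) → case ∈-map⁻ (z ,_) h of λ where
      (_ , _ , refl) → Unique.Unique[x∷xs]⇒x∉xs l! (Precedes⇒∈ˡ (pairs⇒Precedes p k))

  -- The i-th entry, counted from 1, contributes m - i pairs, where m is the length of `l`, which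
  -- gives p m - p (p + 1) / 2; the equation avoids subtraction and division.
  length-pairs : ∀ p (l : List A) → p ≤ length l →
                 2 * length (pairs p l) + p * suc p ≡ 2 * (p * length l)
  length-pairs zero    l       _       = refl
  length-pairs (suc p) (x ∷ l) (s≤s h) = begin
    2 * length (map (x ,_) l ++ pairs p l) + suc p * suc (suc p)
      ≡⟨ cong (λ m → 2 * m + suc p * suc (suc p))
           (≡.trans (length-++ (map (x ,_) l)) (cong (_+ length (pairs p l)) (length-map (x ,_) l))) ⟩
    2 * (length l + length (pairs p l)) + suc p * suc (suc p)
      ≡⟨ solve 3 (λ m t p →
           κ 2 :* (m :+ t) :+ (κ 1 :+ p) :* (κ 2 :+ p) :=
           (κ 2 :* t :+ p :* (κ 1 :+ p)) :+ (κ 2 :* m :+ κ 2 :* (κ 1 :+ p))) refl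
           (length l) (length (pairs p l)) p ⟩
    (2 * length (pairs p l) + p * suc p) + (2 * length l + 2 * suc p)
      ≡⟨ cong (_+ (2 * length l + 2 * suc p)) (length-pairs p l h) ⟩
    2 * (p * length l) + (2 * length l + 2 * suc p)
      ≡⟨ solve 2 (λ m p → κ 2 :* (p :* m) :+ (κ 2 :* m :+ κ 2 :* (κ 1 :+ p)) :=
                          κ 2 :* ((κ 1 :+ p) :* (κ 1 :+ m))) refl (length l) p ⟩
    2 * (suc p * suc (length l)) ∎
    where open ≡.≡-Reasoning

module _ {A : Set} {P Q : A → Set} (Q-unique : ∀ {x y} → Q x → Q y → x ≡ y) where

  -- At most one entry satisfies `Q`: once it is met, all later entries satisfy `P`, and dropping it
  -- costs one in length. In the lower bound, `Q` marks the edge that a single rotation reverses.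
  discard : ∀ {l} → Unique l → All (λ x → P x ⊎ Q x) l →
            ∃ λ k → Unique k × All P k × (∀ {x} → x ∈ₗ k → x ∈ₗ l) × length l ≤ suc (length k)
  discard [] [] = [] , [] , [] , id , z≤n
  discard {x ∷ l} (x≢ ∷ l!) (inj₁ px ∷ h) with discard l! h
  ... | k , k! , pk , k⊆l , le =
    x ∷ k , All.tabulate (All.lookup x≢ ∘ k⊆l) ∷ k! , px ∷ pk ,
    (λ { (here e) → here e ; (there h) → there (k⊆l h) }) , s≤s le
  discard {x ∷ l} (x≢ ∷ l!) (inj₂ qx ∷ h) =
    l , l! , All.tabulate (λ y∈l → case All.lookup h y∈l of λ where
      (inj₁ py) → py
      (inj₂ qy) → contradiction (Q-unique qx qy) (All.lookup x≢ y∈l)) ,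
    there , ℕ.≤-refl

_≟ₛ_ : DecidableEquality (Subset n)
_≟ₛ_ = Vec.≡-dec Bool._≟_

-- Walks and connected components

module _ (G : Graph n) where

  private variable
    S S′ C D X : Subset n
    u v w : Fin n
    l l′ : List (Fin n)

  Adj : Fin n → Fin n → Set
  Adj u v = adj G u v ≡ true

  Adj-sym : Adj u v → Adj v u
  Adj-sym {u} {v} h = ≡.trans (Graph.sym G v u) h

  walk-source : Walk G S u v → u ∈ S
  walk-source (here h)     = h
  walk-source (step h _ _) = h

  walk-target : Walk G S u v → v ∈ S
  walk-target (here h)     = h
  walk-target (step _ _ p) = walk-target p

  walk-trans : Walk G S u v → Walk G S v w → Walk G S u w
  walk-trans (here _)     q = q
  walk-trans (step h a p) q = step h a (walk-trans p q)

  walk-sym : Walk G S u v → Walk G S v u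
  walk-sym (here h)     = here h
  walk-sym (step h a p) = walk-trans (walk-sym p) (step (walk-source p) (Adj-sym a) (here h))

  walk-mono : S ⊆ S′ → Walk G S u v → Walk G S′ u v
  walk-mono f (here h)     = here (f h)
  walk-mono f (step h a p) = step (f h) a (walk-mono f p)

  Closed : Subset n → Subset n → Set
  Closed C S = ∀ {x y} → x ∈ C → y ∈ S → Adj x y → y ∈ C

  walk-restrict : Closed C S → u ∈ C → Walk G S u v → Walk G C u v
  walk-restrict cl u∈C (here _)     = here u∈C
  walk-restrict cl u∈C (step _ a p) = step u∈C a (walk-restrict cl (cl u∈C (walk-source p) a) p)

  -- Cut the walk after its last visit to `u`: either there is no visit, or the walk ends there, or
  -- it leaves `u` along an edge and never comes back.
  walk-avoid : ∀ u → Walk G S w v →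
               Walk G (S - u) w v ⊎ (u ≡ v ⊎ ∃ λ x → Adj u x × Walk G (S - u) x v)
  walk-avoid {w = w} u (here h) with w ≟ u
  ... | yes refl = inj₂ (inj₁ refl)
  ... | no  w≢u  = inj₁ (here (x∈p∧x≢y⇒x∈p-y h w≢u))
  walk-avoid {w = w} u (step h a p) with walk-avoid u p
  ... | inj₂ q = inj₂ q
  ... | inj₁ q with w ≟ u
  ...   | yes refl = inj₂ (inj₂ (_ , a , q))
  ...   | no  w≢u  = inj₁ (step (x∈p∧x≢y⇒x∈p-y h w≢u) a q)

  -- A walk can be assumed not to return to its source, so the vertex set shrinks.
  walk-within? : ∀ m (S : Subset n) → ∣ S ∣ ≤ m → ∀ u v → Dec (Walk G S u v)
  walk-within? m S le u v with u ∈? S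
  ... | no u∉S = no (u∉S ∘ walk-source)
  walk-within? zero S le u v | yes u∈S = contradiction (ℕ.≤-trans (x∈p⇒∣p-x∣<∣p∣ u∈S) le) λ ()
  walk-within? (suc m) S le u v | yes u∈S with u ≟ v
  ... | yes refl = yes (here u∈S)
  ... | no  u≢v  = map′
    (λ (x , a , p) → step u∈S a (walk-mono (p─q⊆p S ⁅ u ⁆) p))
    (λ p → case walk-avoid u p of λ where
      (inj₁ q)        → contradiction refl (x∈p-y⇒x≢y S (walk-source q))
      (inj₂ (inj₁ e)) → contradiction e u≢v
      (inj₂ (inj₂ q)) → q)
    (any? λ x → (adj G u x Bool.≟ true) ×-dec
      walk-within? m (S - u) (s≤s⁻¹ (ℕ.≤-trans (x∈p⇒∣p-x∣<∣p∣ u∈S) le)) x v)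

  walk? : ∀ S u v → Dec (Walk G S u v)
  walk? S = walk-within? ∣ S ∣ S ℕ.≤-refl

  abstract
    component : Subset n → Fin n → Subset n
    component S v = comprehension (walk? S v)

    component⁺ : Walk G S v w → w ∈ component S v
    component⁺ {S} {v} = comprehension⁺ (walk? S v)

    component⁻ : w ∈ component S v → Walk G S v w
    component⁻ {S = S} {v} = comprehension⁻ (walk? S v)

  component-self : v ∈ S → v ∈ component S v
  component-self h = component⁺ (here h)

  component-⊆ : component S v ⊆ S
  component-⊆ = walk-target ∘ component⁻

  component-closed : Closed (component S v) S
  component-closed x∈ y∈S a =
    component⁺ (walk-trans (component⁻ x∈) (step (component-⊆ x∈) a (here y∈S)))

  component-≡ : w ∈ component S v → component S w ≡ component S v
  component-≡ h = ⊆-antisym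
    (component⁺ ∘ walk-trans (component⁻ h) ∘ component⁻)
    (component⁺ ∘ walk-trans (walk-sym (component⁻ h)) ∘ component⁻)

  -- No edge of `S` leaves `C`, so a walk in `S` that starts in `C` stays in `C`.
  component-restrict : C ⊆ S → Closed C S → v ∈ C → component S v ≡ component C v
  component-restrict C⊆S cl v∈C = ⊆-antisym
    (component⁺ ∘ walk-restrict cl v∈C ∘ component⁻)
    (component⁺ ∘ walk-mono C⊆S ∘ component⁻)

  -- A walk from `v` in `S` only visits the component of `v`, so it survives in `S′`.
  component-shrink : S′ ⊆ S → component S v ⊆ S′ → component S′ v ≡ component S v
  component-shrink S′⊆S K⊆S′ = ⊆-antisym
    (component⁺ ∘ walk-mono S′⊆S ∘ component⁻)
    (λ h → let p = component⁻ h in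
      component⁺ (walk-mono K⊆S′ (walk-restrict component-closed (component-self (walk-source p)) p)))

  isComponent⇒closed : IsComponent G S C → Closed C S
  isComponent⇒closed {C = C} (_ , _ , _ , sep) {x} {y} x∈C y∈S a with y ∈? C
  ... | yes y∈C = y∈C
  ... | no  y∉C = case ≡.trans (≡.sym a) (sep x y x∈C y∈S y∉C) of λ ()

  component-isComponent : v ∈ S → IsComponent G S (component S v)
  component-isComponent {v} {S} v∈S =
    component-⊆ , (v , component-self v∈S) ,
    (λ x y x∈ y∈ → walk-restrict component-closed x∈
                     (walk-trans (walk-sym (component⁻ x∈)) (component⁻ y∈))) ,
    λ x y x∈ y∈S y∉ → Bool.¬-not (y∉ ∘ component-closed x∈ y∈S)

  isComponent⇒≡ : IsComponent G S C → v ∈ C → C ≡ component S v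
  isComponent⇒≡ isC@(C⊆S , _ , con , _) v∈C = ⊆-antisym
    (λ w∈C → component⁺ (walk-mono C⊆S (con _ _ v∈C w∈C)))
    (λ w∈ → walk-target (walk-restrict (isComponent⇒closed isC) v∈C (component⁻ w∈)))

  connectedOn⇒≡ : ConnectedOn G S → v ∈ S → component S v ≡ S
  connectedOn⇒≡ con v∈S = ⊆-antisym component-⊆ (component⁺ ∘ con _ _ v∈S)

  -- Tubes of a removal order

  -- Vertices are removed in the order of the list; the tube of a vertex is its
  -- component at the moment it is removed.
  tubes : List (Fin n) → List (Subset n)
  tubes []      = []
  tubes (v ∷ l) = component (set (v ∷ l)) v ∷ tubes l

  tube⊆set : X ∈ₗ tubes l → X ⊆ set l
  tube⊆set {l = v ∷ l} (here refl) = component-⊆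
  tube⊆set {l = v ∷ l} (there h)   = set-there ∘ tube⊆set h

  -- Without edges between the two lists, a walk from a vertex of `l₁` never enters `l₂`, so its
  -- component does not depend on `l₂`.
  tubes-++ : ∀ l₁ {l₂} → (∀ {x y} → x ∈ₗ l₁ → y ∈ₗ l₂ → ¬ Adj x y) →
             tubes (l₁ ++ l₂) ≡ tubes l₁ ++ tubes l₂
  tubes-++ []       _      = refl
  tubes-++ (v ∷ l₁) nonadj = ≡.cong₂ _∷_
    (component-restrict (set-mono (∈-++⁺ˡ {xs = v ∷ l₁}))
      (λ x∈ y∈ a → case ∈-++⁻ (v ∷ l₁) (set⁻ y∈) of λ where
        (inj₁ y∈l₁) → set⁺ y∈l₁
        (inj₂ y∈l₂) → contradiction a (nonadj (set⁻ x∈) y∈l₂))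
      (set⁺ (here refl)))
    (tubes-++ l₁ (nonadj ∘ there))

  restrict : Subset n → List (Fin n) → List (Fin n)
  restrict C = filter (_∈? C)

  set-restrict : C ⊆ set l → set (restrict C l) ≡ C
  set-restrict {C} {l} C⊆l = ⊆-antisym
    (λ h → proj₂ (∈-filter⁻ (_∈? C) {xs = l} (set⁻ h)))
    (λ h → set⁺ (∈-filter⁺ (_∈? C) (set⁻ (C⊆l h)) h))

  component-set-restrict : ∀ l → Closed C (set l) → v ∈ C → v ∈ₗ l →
                           component (set (restrict C l)) v ≡ component (set l) v
  component-set-restrict {C} l cl v∈C v∈l = ≡.sym (component-restrict
    (λ h → set⁺ (proj₁ (split h)))
    (λ h y∈ a → set⁺ (∈-filter⁺ (_∈? C) (set⁻ y∈) (cl (proj₂ (split h)) y∈ a)))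
    (set⁺ (∈-filter⁺ (_∈? C) v∈l v∈C)))
    where
    split : ∀ {x} → x ∈ set (restrict C l) → x ∈ₗ l × x ∈ C
    split h = ∈-filter⁻ (_∈? C) {xs = l} (set⁻ h)

  -- No edge leaves `C` among the vertices still present, so a vertex of `C` has the same component
  -- whether or not the vertices outside `C` are there.
  tubes-restrict⁻ : ∀ l → Closed C (set l) → X ∈ₗ tubes (restrict C l) → X ∈ₗ tubes l
  tubes-restrict⁻ {C} {X} (v ∷ l) cl h with v ∈? C
  ... | no  v∉C = there (tubes-restrict⁻ l (λ x∈ → cl x∈ ∘ set-there) h)
  ... | yes v∈C with h
  ...   | there h′  = there (tubes-restrict⁻ l (λ x∈ → cl x∈ ∘ set-there) h′)
  ...   | here refl = here (≡.trans
            (cong (λ k → component (set k) v) (≡.sym (filter-accept (_∈? C) v∈C)))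
            (component-set-restrict (v ∷ l) cl v∈C (here refl)))

  -- The witness is the vertex whose removal produces `X`. It is chosen before `C`, so that `C` can
  -- afterwards be taken as the component containing it.
  tubes-restrict⁺ : ∀ l → X ∈ₗ tubes l →
    ∃ λ v → v ∈ₗ l × (∀ {C} → Closed C (set l) → v ∈ C → X ∈ₗ tubes (restrict C l))
  tubes-restrict⁺ {X} (v ∷ l) (here refl) = v , here refl , λ {C} cl v∈C →
    subst (λ k → X ∈ₗ tubes k) (≡.sym (filter-accept (_∈? C) v∈C))
      (here (≡.trans (≡.sym (component-set-restrict (v ∷ l) cl v∈C (here refl)))
        (cong (λ k → component (set k) v) (filter-accept (_∈? C) v∈C))))
  tubes-restrict⁺ {X} (v ∷ l) (there h) with tubes-restrict⁺ l h
  ... | w , w∈l , f = w , there w∈l , λ {C} cl w∈C → g {C} (f (λ x∈ → cl x∈ ∘ set-there) w∈C)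
    where
    g : ∀ {C} → X ∈ₗ tubes (restrict C l) → X ∈ₗ tubes (restrict C (v ∷ l))
    g {C} h with v ∈? C
    ... | yes v∈C = there h
    ... | no  v∉C = h

  -- Search trees and removal orders

  components-disjoint : IsComponent G S C → IsComponent G S D → v ∈ C → v ∈ D → C ≡ D
  components-disjoint isC isD v∈C v∈D =
    ≡.trans (isComponent⇒≡ isC v∈C) (≡.sym (isComponent⇒≡ isD v∈D))

  Represents : ST G S → List (Fin n) → Set
  Represents T l = ∀ X → (IsTube G T X → X ∈ₗ tubes l) × (X ∈ₗ tubes l → IsTube G T X)

  mutual
    -- This is a preorder traversal: the root, then the subtrees one after another. Connectedness
    -- makes the component of the root all of `S`, as the tube of the root has to be.
    removalOrder : ConnectedOn G S → (T : ST G S) →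
                   ∃ λ l → Unique l × set l ≡ S × Represents T l
    removalOrder {S} con (node r r∈S cs comps complete cs! ts)
      with removalOrders comps cs! ts
    ... | l , l! , l⊆cs , cs⊆l , eqv =
      r ∷ l , All.tabulate (λ v∈l r≡v → x∈p-y⇒x≢y S (l⊆S-r v∈l) (≡.sym r≡v)) ∷ l! ,
      set≡S , λ X →
        (λ { (inj₁ refl) → here (≡.sym root-tube) ; (inj₂ t) → there (proj₁ (eqv X) t) }) ,
        λ { (here refl) → inj₁ root-tube ; (there t) → inj₂ (proj₂ (eqv X) t) }
      where
      l⊆S-r : ∀ {v} → v ∈ₗ l → v ∈ S - r
      l⊆S-r v∈l with l⊆cs v∈l
      ... | C , C∈cs , v∈C = proj₁ (All.lookup comps C∈cs) v∈C
      S⊆l : ∀ {v} → v ∈ S → v ∈ₗ r ∷ l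
      S⊆l {v} v∈S with v ≟ r
      ... | yes refl = here refl
      ... | no  v≢r  = there (cs⊆l (complete _ (component-isComponent v∈S-r)) (component-self v∈S-r))
        where v∈S-r = x∈p∧x≢y⇒x∈p-y v∈S v≢r
      set≡S : set (r ∷ l) ≡ S
      set≡S = ⊆-antisym
        (λ h → case set⁻ h of λ where
          (here refl)  → r∈S
          (there v∈l) → p─q⊆p S ⁅ r ⁆ (l⊆S-r v∈l))
        (set⁺ ∘ S⊆l)
      root-tube : component (set (r ∷ l)) r ≡ S
      root-tube = ≡.trans (cong (λ S → component S r) set≡S) (connectedOn⇒≡ con r∈S)

    -- Distinct components are disjoint and have no edges between them, so by `tubes-++` the
    -- concatenated orders have exactly the tubes of all subtrees.
    removalOrders : ∀ {cs} → All (IsComponent G S) cs → Unique cs → (ts : All (ST G) cs) →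
      ∃ λ l → Unique l ×
      (∀ {v} → v ∈ₗ l → ∃ λ C → C ∈ₗ cs × v ∈ C) ×
      (∀ {v C} → C ∈ₗ cs → v ∈ C → v ∈ₗ l) ×
      (∀ X → (IsTubeAll G ts X → X ∈ₗ tubes l) × (X ∈ₗ tubes l → IsTubeAll G ts X))
    removalOrders [] [] [] = [] , [] , (λ ()) , (λ ()) , λ X → (λ ()) , λ ()
    removalOrders {S} {C ∷ cs} (isC ∷ comps) (C≢ ∷ cs!) (t ∷ ts)
      with removalOrder (proj₁ (proj₂ (proj₂ isC))) t | removalOrders comps cs! ts
    ... | l₁ , l₁! , refl , eqv₁ | l₂ , l₂! , l₂⊆cs , cs⊆l₂ , eqv₂ =
      l₁ ++ l₂ , Unique.++⁺ l₁! l₂! (λ (v∈l₁ , v∈l₂) →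
        let (_ , D∈cs , v∈D) = l₂⊆cs v∈l₂ in apart v∈l₁ v∈D D∈cs) ,
      (λ v∈ → case ∈-++⁻ l₁ v∈ of λ where
        (inj₁ v∈l₁) → C , here refl , set⁺ v∈l₁
        (inj₂ v∈l₂) → case l₂⊆cs v∈l₂ of λ where (D , D∈cs , v∈D) → D , there D∈cs , v∈D) ,
      (λ { (here refl) v∈C → ∈-++⁺ˡ (set⁻ v∈C) ; (there D∈cs) v∈D → ∈-++⁺ʳ l₁ (cs⊆l₂ D∈cs v∈D) }) ,
      λ X → (λ h → subst (X ∈ₗ_) (≡.sym tubes≡) (case h of λ where
               (inj₁ t) → ∈-++⁺ˡ (proj₁ (eqv₁ X) t)
               (inj₂ t) → ∈-++⁺ʳ (tubes l₁) (proj₁ (eqv₂ X) t))) ,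
            λ h → case ∈-++⁻ (tubes l₁) (subst (X ∈ₗ_) tubes≡ h) of λ where
               (inj₁ t) → inj₁ (proj₂ (eqv₁ X) t)
               (inj₂ t) → inj₂ (proj₂ (eqv₂ X) t)
      where
      apart : ∀ {v D} → v ∈ₗ l₁ → v ∈ D → ¬ D ∈ₗ cs
      apart v∈l₁ v∈D D∈cs =
        All.lookup C≢ D∈cs (components-disjoint isC (All.lookup comps D∈cs) (set⁺ v∈l₁) v∈D)
      tubes≡ : tubes (l₁ ++ l₂) ≡ tubes l₁ ++ tubes l₂
      tubes≡ = tubes-++ l₁ λ {x} {y} x∈l₁ y∈l₂ a → case l₂⊆cs y∈l₂ of λ where
        (D , D∈cs , y∈D) → apart
          (set⁻ (isComponent⇒closed isC (set⁺ x∈l₁) (proj₁ (All.lookup comps D∈cs) y∈D) a)) y∈D D∈cs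

  unzip : ∀ {cs} {f : Subset n → List (Fin n)} →
    All (λ C → Σ (ST G C) (λ T → Represents T (f C))) cs →
    Σ (All (ST G) cs) λ ts → ∀ X →
      (IsTubeAll G ts X → ∃ λ C → C ∈ₗ cs × X ∈ₗ tubes (f C)) ×
      (∀ {C} → C ∈ₗ cs → X ∈ₗ tubes (f C) → IsTubeAll G ts X)
  unzip []                = [] , λ X → (λ ()) , λ ()
  unzip ((T , rep) ∷ Ts) with unzip Ts
  ... | ts , eqv = T ∷ ts , λ X →
    (λ { (inj₁ t) → _ , here refl , proj₁ (rep X) t
       ; (inj₂ t) → case proj₁ (eqv X) t of λ where (C , C∈ , h) → C , there C∈ , h }) ,
    λ { (here refl) h → inj₁ (proj₂ (rep X) h) ; (there C∈) h → inj₂ (proj₂ (eqv X) C∈ h) }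

  -- The first vertex is the root, and the subtree on a component `C` of the rest comes from the
  -- order restricted to `C`. Such a restriction is not a structural sublist, hence the recursion on
  -- the length bound `m`.
  searchTree : ∀ m l → length l ≤ m → ConnectedOn G (set l) → Nonempty (set l) → Unique l →
               Σ (ST G (set l)) λ T → Represents T l
  searchTree m [] _ _ (_ , v∈) _ = case set⁻ v∈ of λ ()
  searchTree (suc m) (r ∷ l) (s≤s len) con _ (r≢ ∷ l!) =
    node r (set⁺ (here refl)) cs (subst (λ S → All (IsComponent G S) cs) (≡.sym S-r≡) comps)
      (λ C isC → complete (subst (λ S → IsComponent G S C) S-r≡ isC))
      (DecUnique.deduplicate-! _≟ₛ_ _) (proj₁ subtrees) ,
    λ X → (λ { (inj₁ refl) → here (≡.sym root-tube) ; (inj₂ t) → there (down t) }) ,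
          λ { (here refl) → inj₁ root-tube ; (there t) → inj₂ (up t) }
    where
    S-r≡ : set (r ∷ l) - r ≡ set l
    S-r≡ = ⊆-antisym
      (λ h → case set⁻ (p─q⊆p (set (r ∷ l)) ⁅ r ⁆ h) of λ where
        (here refl) → contradiction refl (x∈p-y⇒x≢y (set (r ∷ l)) h)
        (there v∈l) → set⁺ v∈l)
      (λ h → x∈p∧x≢y⇒x∈p-y (set-there h) λ { refl → All.lookup r≢ (set⁻ h) refl })
    -- Vertices of one component all yield the same set, which may be listed only once.
    cs = deduplicate _≟ₛ_ (map (component (set l)) l)
    comps : All (IsComponent G (set l)) cs
    comps = All.tabulate λ C∈cs → case ∈-map⁻ _ (∈-deduplicate⁻ _≟ₛ_ _ C∈cs) of λ where
      (v , v∈l , refl) → component-isComponent (set⁺ v∈l)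
    subtree : ∀ {C} → IsComponent G (set l) C → Σ (ST G C) λ T → Represents T (restrict C l)
    subtree {C} (C⊆ , ne , conC , _) =
      subst (λ S → Σ (ST G S) λ T → Represents T (restrict C l)) (set-restrict C⊆)
        (searchTree m (restrict C l) (ℕ.≤-trans (length-filter (_∈? C) l) len)
          (subst (ConnectedOn G) (≡.sym (set-restrict C⊆)) conC)
          (subst Nonempty (≡.sym (set-restrict C⊆)) ne)
          (Unique.filter⁺ (_∈? C) l!))
    subtrees = unzip {f = λ C → restrict C l} (All.map subtree comps)
    root-tube = connectedOn⇒≡ con (set⁺ (here refl))
    ∈cs : ∀ {v} → v ∈ₗ l → component (set l) v ∈ₗ cs
    ∈cs v∈l = ∈-deduplicate⁺ _≟ₛ_ (∈-map⁺ (component (set l)) v∈l)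
    complete : ∀ {C} → IsComponent G (set l) C → C ∈ₗ cs
    complete isC@(C⊆ , (v , v∈C) , _) =
      subst (_∈ₗ cs) (≡.sym (isComponent⇒≡ isC v∈C)) (∈cs (set⁻ (C⊆ v∈C)))
    down : ∀ {X} → IsTubeAll G (proj₁ subtrees) X → X ∈ₗ tubes l
    down t with proj₁ (proj₂ subtrees _) t
    ... | C , C∈cs , h = tubes-restrict⁻ l (isComponent⇒closed (All.lookup comps C∈cs)) h
    up : ∀ {X} → X ∈ₗ tubes l → IsTubeAll G (proj₁ subtrees) X
    up h with tubes-restrict⁺ l h
    ... | v , v∈l , f = proj₂ (proj₂ subtrees _) (∈cs v∈l) (f component-closed (component-self (set⁺ v∈l)))

  -- Exchanging consecutive vertices

  record Flip (l l′ : List (Fin n)) : Set where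
    field
      old new  : Subset n
      old∈     : old ∈ₗ tubes l
      old∉     : old ∉ₗ tubes l′
      new∈     : new ∈ₗ tubes l′
      new∉     : new ∉ₗ tubes l
      forward  : ∀ {X} → X ∈ₗ tubes l  → X ≡ old ⊎ X ∈ₗ tubes l′
      backward : ∀ {X} → X ∈ₗ tubes l′ → X ≡ new ⊎ X ∈ₗ tubes l

  Flip-sym : Flip l l′ → Flip l′ l
  Flip-sym f = record
    { old = new ; new = old ; old∈ = new∈ ; old∉ = new∉ ; new∈ = old∈ ; new∉ = old∉
    ; forward = backward ; backward = forward }
    where open Flip f

  -- Removing `x` first adds the same tube on both sides. That tube contains `x`, which no later
  -- tube does, so it is neither of the two exchanged tubes.
  Flip-∷ : ∀ {x} → l ↭ l′ → x ∉ₗ l → Flip l l′ → Flip (x ∷ l) (x ∷ l′)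
  Flip-∷ {l} {l′} {x} p x∉l f = record
    { old = old ; new = new
    ; old∈ = there old∈ ; old∉ = [ fresh x∉l old∈ , old∉ ]′ ∘ split
    ; new∈ = there new∈ ; new∉ = [ fresh (x∉l ∘ ∈-resp-↭ (↭-sym p)) new∈ , new∉ ]′ ∘ split
    ; forward  = λ { (here eq) → inj₂ (here (≡.trans eq (cong (λ S → component S x) set≡)))
                   ; (there h) → map₂ there (forward h) }
    ; backward = λ { (here eq) → inj₂ (here (≡.trans eq (cong (λ S → component S x) (≡.sym set≡))))
                   ; (there h) → map₂ there (backward h) } }
    where
    open Flip f
    set≡ = set-↭ (Perm.prep x p)
    split : ∀ {k X} → X ∈ₗ tubes (x ∷ k) → X ≡ component (set (x ∷ k)) x ⊎ X ∈ₗ tubes k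
    split (here eq) = inj₁ eq
    split (there h) = inj₂ h
    fresh : ∀ {k X S} → x ∉ₗ k → X ∈ₗ tubes k → ¬ X ≡ component (set (x ∷ S)) x
    fresh x∉k h refl = x∉k (set⁻ (tube⊆set h (component-self (set⁺ (here refl)))))

  module _ {u v : Fin n} {m : List (Fin n)} (l! : Unique (u ∷ v ∷ m)) where

    private
      K  = component (set (u ∷ v ∷ m)) u
      K′ = component (set (v ∷ u ∷ m)) v
      set≡ : set (u ∷ v ∷ m) ≡ set (v ∷ u ∷ m)
      set≡ = set-↭ (Perm.swap u v Perm.refl)

      u∉ : u ∉ₗ v ∷ m
      u∉ = Unique.Unique[x∷xs]⇒x∉xs l!

      v∉ : v ∉ₗ u ∷ m
      v∉ = Unique.Unique[x∷xs]⇒x∉xs (Unique-↭ (Perm.swap u v Perm.refl) l!)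

      -- This tube misses `y`, which lies in `L`, and contains `x`, which lies in none of the
      -- remaining tubes.
      fresh : ∀ {x y L} → x ∉ₗ y ∷ m → y ∉ₗ x ∷ m → y ∈ L →
              component (set (x ∷ m)) x ∉ₗ L ∷ component (set (y ∷ m)) y ∷ tubes m
      fresh {y = y} x∉ y∉ y∈L (here eq) =
        y∉ (set⁻ (component-⊆ (subst (y ∈_) (≡.sym eq) y∈L)))
      fresh {x} x∉ y∉ y∈L (there (here eq)) =
        x∉ (set⁻ (component-⊆ (subst (x ∈_) eq (component-self (set⁺ (here refl))))))
      fresh x∉ y∉ y∈L (there (there h)) =
        x∉ (there (set⁻ (tube⊆set h (component-self (set⁺ (here refl))))))

    -- When `u` and `v` share a component, that component is the first tube in either order. Only
    -- the second tube changes: the component of `v` without `u` becomes that of `u` without `v`.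
    Flip-swap : v ∈ component (set (u ∷ v ∷ m)) u → Flip (u ∷ v ∷ m) (v ∷ u ∷ m)
    Flip-swap v∈K = record
      { old = component (set (v ∷ m)) v ; new = component (set (u ∷ m)) u
      ; old∈ = there (here refl) ; new∈ = there (here refl)
      ; old∉ = fresh v∉ u∉ (subst (u ∈_) (≡.sym K′≡K) (component-self (set⁺ (here refl))))
      ; new∉ = fresh u∉ v∉ v∈K
      ; forward = λ where
          (here eq)          → inj₂ (here (≡.trans eq (≡.sym K′≡K)))
          (there (here eq))  → inj₁ eq
          (there (there h))  → inj₂ (there (there h))
      ; backward = λ where
          (here eq)          → inj₂ (here (≡.trans eq K′≡K))
          (there (here eq))  → inj₁ eq
          (there (there h))  → inj₂ (there (there h)) }
      where
      K′≡K : K′ ≡ K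
      K′≡K = ≡.trans (cong (λ S → component S v) (≡.sym set≡)) (component-≡ v∈K)

    module _ (v∉K : v ∉ component (set (u ∷ v ∷ m)) u) where

      private
        K≡ : component (set (u ∷ m)) u ≡ K
        K≡ = component-shrink
          (set-mono λ { (here e) → here e ; (there h) → there (there h) })
          λ h → case set⁻ (component-⊆ h) of λ where
            (here refl)         → set⁺ (here refl)
            (there (here refl)) → contradiction h v∉K
            (there (there h))   → set⁺ (there h)

        K′≡ : component (set (v ∷ m)) v ≡ K′
        K′≡ = component-shrink
          (set-mono λ { (here e) → here e ; (there h) → there (there h) })
          λ h → case set⁻ (component-⊆ h) of λ where
            (here refl)         → set⁺ (here refl)
            (there (here refl)) → contradiction
              (component⁺ (walk-sym (subst (λ S → Walk G S v u) (≡.sym set≡) (component⁻ h)))) v∉K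
            (there (there h))   → set⁺ (there h)

      -- When `u` and `v` lie in different components, removing one does not change the component of
      -- the other (`K≡` and `K′≡`), so the two tubes merely trade places.
      tubes-swap⁺ : ∀ {X} → X ∈ₗ tubes (u ∷ v ∷ m) → X ∈ₗ tubes (v ∷ u ∷ m)
      tubes-swap⁺ (here eq)         = there (here (≡.trans eq (≡.sym K≡)))
      tubes-swap⁺ (there (here eq)) = here (≡.trans eq K′≡)
      tubes-swap⁺ (there (there h)) = there (there h)

      tubes-swap⁻ : ∀ {X} → X ∈ₗ tubes (v ∷ u ∷ m) → X ∈ₗ tubes (u ∷ v ∷ m)
      tubes-swap⁻ (here eq)         = there (here (≡.trans eq (≡.sym K′≡)))
      tubes-swap⁻ (there (here eq)) = here (≡.trans eq K≡)
      tubes-swap⁻ (there (there h)) = there (there h)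

  -- Sequences of flips

  -- Path l l′ c: the tree of l′ is reached from that of l by at most c rotations.
  data Path : List (Fin n) → List (Fin n) → ℕ → Set where
    same  : ∀ {l l′ c} → l ↭ l′ → (∀ {X} → X ∈ₗ tubes l → X ∈ₗ tubes l′) →
            (∀ {X} → X ∈ₗ tubes l′ → X ∈ₗ tubes l) → Path l l′ c
    flip  : ∀ {l l′ c} → l ↭ l′ → Flip l l′ → Path l l′ (suc c)
    trans : ∀ {l m l′ j k c} → Path l m j → Path m l′ k → j + k ≤ c → Path l l′ c

  Path-refl : ∀ {c} → Path l l c
  Path-refl = same Perm.refl id id

  Path⇒↭ : ∀ {c} → Path l l′ c → l ↭ l′
  Path⇒↭ (same p _ _)  = p
  Path⇒↭ (flip p _)    = p
  Path⇒↭ (trans p q _) = Perm.trans (Path⇒↭ p) (Path⇒↭ q)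

  Path-sym : ∀ {c} → Path l l′ c → Path l′ l c
  Path-sym (same p f g) = same (↭-sym p) g f
  Path-sym (flip p f)   = flip (↭-sym p) (Flip-sym f)
  Path-sym (trans {j = j} {k} p q le) =
    trans (Path-sym q) (Path-sym p) (ℕ.≤-trans (ℕ.≤-reflexive (ℕ.+-comm k j)) le)

  Path-∷ : ∀ {x c} → x ∉ₗ l → Path l l′ c → Path (x ∷ l) (x ∷ l′) c
  Path-∷ {x = x} x∉ (same p f g) = same (Perm.prep x p) (cons p f) (cons (↭-sym p) g)
    where
    cons : ∀ {l l′} → l ↭ l′ → (∀ {X} → X ∈ₗ tubes l → X ∈ₗ tubes l′) →
           ∀ {X} → X ∈ₗ tubes (x ∷ l) → X ∈ₗ tubes (x ∷ l′)
    cons p f (here eq) = here (≡.trans eq (cong (λ S → component S x) (set-↭ (Perm.prep x p))))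
    cons p f (there h) = there (f h)
  Path-∷ x∉ (flip p f)     = flip (Perm.prep _ p) (Flip-∷ p x∉ f)
  Path-∷ x∉ (trans p q le) =
    trans (Path-∷ x∉ p) (Path-∷ (x∉ ∘ ∈-resp-↭ (↭-sym (Path⇒↭ p))) q) le

  -- The vertex `v` passes the entries of `as` from right to left. Passing `a` is a rotation only
  -- when both are in one component of what remains, and then `a` is reachable from `v` and hence in
  -- `K`.
  Path-front : ∀ as {v bs} K → Unique (as ++ v ∷ bs) →
    (∀ {w} → Walk G (set (as ++ v ∷ bs)) v w → w ∈ₗ K) →
    Path (as ++ v ∷ bs) (v ∷ as ++ bs) (length (filter (_∈ₗ? K) as))
  Path-front []       K _ _ = Path-refl
  Path-front (a ∷ as) {v} {bs} K l!@(_ ∷ l!′) reach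
    with Path-∷ (Unique.Unique[x∷xs]⇒x∉xs l!) (Path-front as K l!′ (reach ∘ walk-mono set-there))
       | Perm.prep a (shift v as bs)
  ... | p | q with v ∈? component (set (a ∷ v ∷ as ++ bs)) a
  ...   | yes v∈ = subst (Path _ _ ∘ length) (≡.sym (filter-accept (_∈ₗ? K) a∈K))
            (trans p (flip {c = 0} (Perm.swap a v Perm.refl) (Flip-swap (Unique-↭ q l!) v∈))
              (ℕ.≤-reflexive (ℕ.+-comm _ 1)))
    where
    a∈K : a ∈ₗ K
    a∈K = reach (walk-sym (subst (λ S → Walk G S a v) (set-↭ (↭-sym q)) (component⁻ v∈)))
  -- This exchange is free; the bound may still grow by one, as `a` can lie in `K`.
  ...   | no v∉ = trans {k = 0} p
            (same (Perm.swap a v Perm.refl) (tubes-swap⁺ q! v∉) (tubes-swap⁻ q! v∉))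
            (ℕ.≤-trans (ℕ.≤-reflexive (ℕ.+-identityʳ _)) (filter-grows a))
    where
    q! = Unique-↭ q l!
    filter-grows : ∀ a → length (filter (_∈ₗ? K) as) ≤ length (filter (_∈ₗ? K) (a ∷ as))
    filter-grows a with a ∈ₗ? K
    ... | yes _ = ℕ.n≤1+n _
    ... | no  _ = ℕ.≤-refl

  -- Sorting into a target order

  -- An upper bound for the sum of the sizes of the tubes.
  data Cost : List (Fin n) → ℕ → Set where
    []  : ∀ {c} → Cost [] c
    add : ∀ {v l k c} (K : List (Fin n)) → (∀ {w} → Walk G (set (v ∷ l)) v w → w ∈ₗ K) →
          Cost l k → length K + k ≤ c → Cost (v ∷ l) c

  Cost-≤ : ∀ {b c} → b ≤ c → Cost l b → Cost l c
  Cost-≤ b≤c []             = []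
  Cost-≤ b≤c (add K f r le) = add K f r (ℕ.≤-trans le b≤c)

  -- Selection sort: the next vertex of the target order only has to overtake
  -- vertices of its own tube, since exchanging unrelated neighbours is free.
  Path-sort : ∀ {c} → Cost l′ c → Unique l → l ↭ l′ → Path l l′ c
  Path-sort [] _ p with ↭-empty-inv p
  ... | refl = Path-refl
  Path-sort {l = l} (add {v} {l′} {k} K reach r le) l! p with ∈-∃++ (∈-resp-↭ (↭-sym p) (here refl))
  ... | as , bs , refl = trans
    (Path-front as K l! (reach ∘ subst (λ S → Walk G S v _) (set-↭ p)))
    (Path-∷ (Unique.Unique[x∷xs]⇒x∉xs vl!) (Path-sort r (AllPairs.tail vl!) (drop-mid as [] p)))
    -- The overtaken vertices that cost a rotation are distinct members of `K`, so there are at most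
    -- `length K` of them.
    (ℕ.≤-trans (ℕ.+-monoˡ-≤ k (unique-⊆⇒length≤
      (Unique.filter⁺ (_∈ₗ? K) (Unique-++⁻ˡ as l!)) (λ h → proj₂ (∈-filter⁻ (_∈ₗ? K) {xs = as} h)))) le)
    where
    vl! : Unique (v ∷ as ++ bs)
    vl! = Unique-↭ (shift v as bs) l!

  -- As in `tubes-++`, vertices of `l₁` do not reach `l₂`, so each keeps its own list `K`.
  Cost-++ : ∀ {l₁ l₂ c₁ c₂} → (∀ {x y} → x ∈ₗ l₁ → y ∈ₗ l₂ → ¬ Adj x y) →
            Cost l₁ c₁ → Cost l₂ c₂ → Cost (l₁ ++ l₂) (c₁ + c₂)
  Cost-++ {c₁ = c₁} nonadj [] r₂ = Cost-≤ (ℕ.m≤n+m _ c₁) r₂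
  Cost-++ {l₁} {l₂} {c₂ = c₂} nonadj (add {k = k} K reach r₁ le) r₂ =
    add K
      (reach ∘ walk-restrict
        (λ x∈ y∈ a → case ∈-++⁻ l₁ (set⁻ y∈) of λ where
          (inj₁ y∈l₁) → set⁺ y∈l₁
          (inj₂ y∈l₂) → contradiction a (nonadj (set⁻ x∈) y∈l₂))
        (set⁺ (here refl)))
      (Cost-++ (nonadj ∘ there) r₁ r₂)
      (ℕ.≤-trans (ℕ.≤-reflexive (≡.sym (ℕ.+-assoc (length K) k c₂))) (ℕ.+-monoˡ-≤ c₂ le))

  -- Each separator vertex is charged everything still present, which is at most `m` vertices.
  Cost-separator : ∀ {m r c} s → length (s ++ r) ≤ m → Cost r c → Cost (s ++ r) (length s * m + c)
  Cost-separator []      le R = R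
  Cost-separator {m} {r} {c} (v ∷ s) le R =
    add (v ∷ s ++ r) (set⁻ ∘ walk-target) (Cost-separator s (ℕ.≤-trans (ℕ.n≤1+n _) le) R)
      (ℕ.≤-trans (ℕ.+-monoˡ-≤ _ le) (ℕ.≤-reflexive (≡.sym (ℕ.+-assoc m (length s * m) c))))

  -- Balanced separators from an interval supergraph

  length-filters : ∀ {P Q : Fin n → Set} (P? : Decidable P) (Q? : Decidable Q) →
    (∀ {v} → P v → ¬ Q v) → Unique l → length (filter P? l) + length (filter Q? l) ≤ length l
  length-filters {l} P? Q? disj l! = ℕ.≤-trans (ℕ.≤-reflexive (≡.sym (length-++ (filter P? l))))
    (unique-⊆⇒length≤ {ys = l}
      (Unique.++⁺ (Unique.filter⁺ P? l!) (Unique.filter⁺ Q? l!)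
        λ (p , q) → disj (proj₂ (∈-filter⁻ P? {xs = l} p)) (proj₂ (∈-filter⁻ Q? {xs = l} q)))
      λ h → case ∈-++⁻ (filter P? l) h of λ where
        (inj₁ p) → proj₁ (∈-filter⁻ P? p)
        (inj₂ q) → proj₁ (∈-filter⁻ Q? q))

  module Intervals {p : ℕ} (a b : Fin n → ℕ) (a≤b : ∀ v → a v ≤ b v)
    (meets : ∀ u v → Adj u v → Overlap G a b u v)
    (clique : ∀ (K : Subset n) → (∀ u v → u ∈ K → v ∈ K → u ≢ v → Overlap G a b u v) →
              ∣ K ∣ ≤ suc p)
    where

    Before At After : ℕ → Fin n → Set
    Before x v = b v < x
    At     x v = a v ≤ x × x ≤ b v
    After  x v = x < a v

    before? : ∀ x → Decidable (Before x)
    before? x v = b v <? x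
    at? : ∀ x → Decidable (At x)
    at? x v = (a v ≤? x) ×-dec (x ≤? b v)
    after? : ∀ x → Decidable (After x)
    after? x v = x <? a v
    beyond? : ∀ x → Decidable (λ v → x < b v)
    beyond? x v = x <? b v

    -- All these intervals contain `x`, so they overlap pairwise and form a clique of the interval
    -- supergraph.
    length-at : ∀ x → Unique l → length (filter (at? x) l) ≤ suc p
    length-at {l} x l! = ℕ.≤-trans
      (unique-⊆⇒length≤∣∣ (Unique.filter⁺ (at? x) l!) set⁺)
      (clique (set (filter (at? x) l)) λ u v u∈ v∈ _ →
        x , proj₂ (∈-filter⁻ (at? x) {xs = l} (set⁻ u∈)) , proj₂ (∈-filter⁻ (at? x) {xs = l} (set⁻ v∈)))

    -- Intervals of adjacent vertices share a point, which here would lie on both sides of `x`.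
    before-after : ∀ {x u v} → Before x u → After x v → ¬ Adj u v
    before-after {x} {u} {v} u<x x<v adj with meets u v adj
    ... | y , (_ , y≤bu) , (av≤y , _) =
      ℕ.<-irrefl refl (ℕ.<-trans (ℕ.≤-<-trans y≤bu u<x) (ℕ.<-≤-trans x<v av≤y))

    rearranged : ℕ → List (Fin n) → List (Fin n)
    rearranged x l = filter (at? x) l ++ filter (before? x) l ++ filter (after? x) l

    rearrange : ∀ x → Unique l → l ↭ rearranged x l
    rearrange {l} x l! = unique⇒↭ l!
      (Unique.++⁺ (Unique.filter⁺ (at? x) l!)
        (Unique.++⁺ (Unique.filter⁺ (before? x) l!) (Unique.filter⁺ (after? x) l!)
          λ (h , k) → ba (proj₂ (∈-filter⁻ (before? x) {xs = l} h)) (proj₂ (∈-filter⁻ (after? x) {xs = l} k)))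
        λ {v} (h , k) → case proj₂ (∈-filter⁻ (at? x) {xs = l} h) of λ where
          (av≤x , x≤bv) → case ∈-++⁻ (filter (before? x) l) k of λ where
            (inj₁ k) → ℕ.<⇒≱ (proj₂ (∈-filter⁻ (before? x) {xs = l} k)) x≤bv
            (inj₂ k) → ℕ.<⇒≱ (proj₂ (∈-filter⁻ (after? x) {xs = l} k)) av≤x)
      f g
      where
      ba : ∀ {v} → Before x v → After x v → ⊥
      ba {v} p q = ℕ.<-irrefl refl (ℕ.<-trans (ℕ.<-≤-trans q (a≤b v)) p)
      f : ∀ {v} → v ∈ₗ l → v ∈ₗ rearranged x l
      f {v} h with before? x v | after? x v
      ... | yes p | _     = ∈-++⁺ʳ (filter (at? x) l) (∈-++⁺ˡ (∈-filter⁺ (before? x) h p))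
      ... | no _  | yes q = ∈-++⁺ʳ (filter (at? x) l) (∈-++⁺ʳ (filter (before? x) l) (∈-filter⁺ (after? x) h q))
      ... | no ¬p | no ¬q = ∈-++⁺ˡ (∈-filter⁺ (at? x) h (ℕ.≮⇒≥ ¬q , ℕ.≮⇒≥ ¬p))
      g : ∀ {v} → v ∈ₗ rearranged x l → v ∈ₗ l
      g h with ∈-++⁻ (filter (at? x) l) h
      ... | inj₁ h = proj₁ (∈-filter⁻ (at? x) h)
      ... | inj₂ h with ∈-++⁻ (filter (before? x) l) h
      ...   | inj₁ h = proj₁ (∈-filter⁻ (before? x) h)
      ...   | inj₂ h = proj₁ (∈-filter⁻ (after? x) h)

    after⊆beyond : ∀ x → Unique l → length (filter (after? x) l) ≤ length (filter (beyond? x) l)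
    after⊆beyond {l} x l! = unique-⊆⇒length≤ (Unique.filter⁺ (after? x) l!) λ h →
      let (h , q) = ∈-filter⁻ (after? x) {xs = l} h in ∈-filter⁺ (beyond? x) h (ℕ.<-≤-trans q (a≤b _))

    Balanced : ℕ → List (Fin n) → ℕ → Set
    Balanced N l x = length (filter (before? x) l) < N × length (filter (after? x) l) < N

    -- The position moves left while fewer than `N` intervals end beyond it; this also bounds those
    -- starting after it. The search stops when at least `N` intervals end beyond the next position
    -- to the left: the others are then fewer than `N`, and they are exactly those ending before the
    -- current one.
    balance : ∀ {N} x → Unique l → length l < N + N → length (filter (beyond? x) l) < N →
              ∃ (Balanced N l)
    balance {l} {N} zero l! len few = 0 ,
      subst (_< N) (≡.sym (cong length (filter-none (before? 0) {xs = l} (All.tabulate λ _ ()))))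
        (ℕ.≤-<-trans z≤n few) ,
      ℕ.≤-<-trans (after⊆beyond 0 l!) few
    balance {l} {N} (suc x) l! len few with length (filter (beyond? x) l) <? N
    ... | yes few′ = balance x l! len few′
    ... | no ¬few  = suc x ,
      ℕ.+-cancelʳ-< _ _ _ (ℕ.≤-<-trans
        (ℕ.≤-trans (ℕ.+-monoʳ-≤ _ (ℕ.≮⇒≥ ¬few))
          (length-filters (before? (suc x)) (beyond? x) (λ { (s≤s p) q → ℕ.<⇒≱ q p }) l!)) len) ,
      ℕ.≤-<-trans (after⊆beyond (suc x) l!) few

    bounded : ∀ (l : List (Fin n)) → ∃ λ x → ∀ {v} → v ∈ₗ l → b v ≤ x
    bounded []      = 0 , λ ()
    bounded (v ∷ l) with bounded l
    ... | x , f = b v ⊔ x , λ where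
      (here refl) → ℕ.m≤m⊔n (b v) x
      (there h)   → ℕ.≤-trans (f h) (ℕ.m≤n⊔m (b v) x)

    balancedPoint : ∀ {N} → Unique l → length l < N + N → 0 < N → ∃ (Balanced N l)
    balancedPoint {l} {N} l! len 0<N with bounded l
    -- The search starts at a position beyond which no interval ends.
    ... | x , f = balance x l! len
      (subst (_< N) (≡.sym (cong length (filter-none (beyond? x) (All.tabulate λ h → ℕ.≤⇒≯ (f h))))) 0<N)

    -- The at most p + 1 vertices at a balanced point go first and pay at most `length l` each. The
    -- two sides have no edges between them, have fewer than `2 ^ d` vertices each, and together at
    -- most `length l`. So each of the `d` levels of the recursion costs at most `suc p * length l`.
    dissection : ∀ d l → Unique l → length l < 2 ^ d →
                 ∃ λ l₀ → l ↭ l₀ × Cost l₀ (suc p * length l * d)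
    dissection zero    []      _ _           = [] , Perm.refl , []
    dissection zero    (_ ∷ _) _ (s≤s ())
    dissection (suc d) l l! len
      with balancedPoint l! (subst (length l <_) (cong (2 ^ d +_) (ℕ.+-identityʳ (2 ^ d))) len) (ℕ.m^n>0 2 d)
    ... | x , few₁ , few₂
      with dissection d (filter (before? x) l) (Unique.filter⁺ (before? x) l!) few₁
         | dissection d (filter (after? x) l) (Unique.filter⁺ (after? x) l!) few₂
    ... | l₁ , σ₁ , r₁ | l₂ , σ₂ , r₂ =
      filter (at? x) l ++ l₁ ++ l₂ , σ ,
      Cost-≤ bound (Cost-separator (filter (at? x) l) (ℕ.≤-reflexive (≡.sym (↭-length σ)))
        (Cost-++ (λ h k → before-after
          (proj₂ (∈-filter⁻ (before? x) {xs = l} (∈-resp-↭ (↭-sym σ₁) h)))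
          (proj₂ (∈-filter⁻ (after? x) {xs = l} (∈-resp-↭ (↭-sym σ₂) k)))) r₁ r₂))
      where
      σ : l ↭ filter (at? x) l ++ l₁ ++ l₂
      σ = Perm.trans (rearrange x l!) (++⁺ˡ (filter (at? x) l) (++⁺ σ₁ σ₂))
      m₁ = length (filter (before? x) l)
      m₂ = length (filter (after? x) l)
      open ℕ.≤-Reasoning
      bound : length (filter (at? x) l) * length l + (suc p * m₁ * d + suc p * m₂ * d)
              ≤ suc p * length l * suc d
      bound = begin
        length (filter (at? x) l) * length l + (suc p * m₁ * d + suc p * m₂ * d)
          ≡⟨ cong (length (filter (at? x) l) * length l +_)
               (≡.trans (≡.sym (ℕ.*-distribʳ-+ d (suc p * m₁) (suc p * m₂)))
                        (cong (_* d) (≡.sym (ℕ.*-distribˡ-+ (suc p) m₁ m₂)))) ⟩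
        length (filter (at? x) l) * length l + suc p * (m₁ + m₂) * d
          ≤⟨ ℕ.+-mono-≤ (ℕ.*-monoˡ-≤ (length l) (length-at x l!))
               (ℕ.*-monoˡ-≤ d (ℕ.*-monoʳ-≤ (suc p)
                 (length-filters (before? x) (after? x)
                   (λ {v} u w → ℕ.<-irrefl refl (ℕ.<-trans (ℕ.<-≤-trans w (a≤b v)) u)) l!))) ⟩
        suc p * length l + suc p * length l * d
          ≡⟨ ≡.sym (ℕ.*-suc (suc p * length l) d) ⟩
        suc p * length l * suc d ∎

  -- From orders back to rotations of search trees

  SameTubes-sym : ∀ {T U : SearchTree G} → SameTubes G T U → SameTubes G U T
  SameTubes-sym h X = proj₂ (h X) , proj₁ (h X)

  SameTubes-trans : ∀ {T U V : SearchTree G} → SameTubes G T U → SameTubes G U V → SameTubes G T V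
  SameTubes-trans h k X = proj₁ (k X) ∘ proj₁ (h X) , proj₂ (h X) ∘ proj₂ (k X)

  Rotation-sym : ∀ {T U : SearchTree G} → Rotation G T U → Rotation G U T
  Rotation-sym (A , B , A≢B , hA , hB , only) =
    A , B , A≢B , swap hA , swap hB , λ X → only X ∘ swap

  InSymDiff-resp : ∀ {T T′ U : SearchTree G} → SameTubes G T T′ →
                   ∀ X → InSymDiff G T U X → InSymDiff G T′ U X
  InSymDiff-resp h X = [ (λ (t , ¬u) → inj₁ (proj₁ (h X) t , ¬u)) ,
                         (λ (u , ¬t) → inj₂ (u , ¬t ∘ proj₂ (h X))) ]′

  Rotation-resp : ∀ {T T′ U : SearchTree G} → SameTubes G T T′ → Rotation G T U → Rotation G T′ U
  Rotation-resp {T} {T′} {U} h (A , B , A≢B , hA , hB , only) =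
    A , B , A≢B , InSymDiff-resp {T} {T′} {U} h A hA , InSymDiff-resp {T} {T′} {U} h B hB ,
    λ X → only X ∘ InSymDiff-resp {T′} {T} {U} (SameTubes-sym {T} {T′} h) X

  RotPath-resp : ∀ {T T′ U : SearchTree G} {k} → SameTubes G T T′ → RotPath G T U k → RotPath G T′ U k
  RotPath-resp {T} {T′} {U} h (stop s) =
    stop (SameTubes-trans {T′} {T} {U} (SameTubes-sym {T} {T′} h) s)
  RotPath-resp {T} {T′} h (step {V = V} r p) = step (Rotation-resp {T} {T′} {V} h r) p

  RotPath-trans : ∀ {T U V : SearchTree G} {j k} →
                  RotPath G T U j → RotPath G U V k → RotPath G T V (j + k)
  RotPath-trans {T} {U} (stop h) q = RotPath-resp {U} {T} (SameTubes-sym {T} {U} h) q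
  RotPath-trans (step r p) q = step r (RotPath-trans p q)

  Flip⇒Rotation : ∀ {T U : SearchTree G} → Represents T l → Represents U l′ →
                  Flip l l′ → Rotation G T U
  Flip⇒Rotation repT repU f = old , new , (λ { refl → new∉ old∈ }) ,
    inj₁ (proj₂ (repT old) old∈ , old∉ ∘ proj₁ (repU old)) ,
    inj₂ (proj₂ (repU new) new∈ , new∉ ∘ proj₁ (repT new)) ,
    λ X → [ (λ (t , ¬u) → [ inj₁ , (λ h → contradiction (proj₂ (repU X) h) ¬u) ]′
                            (forward (proj₁ (repT X) t)))
          , (λ (u , ¬t) → [ inj₂ , (λ h → contradiction (proj₂ (repT X) h) ¬t) ]′
                            (backward (proj₁ (repU X) u))) ]′
    where open Flip f

  Full : List (Fin n) → Set
  Full l = Unique l × (∀ v → v ∈ₗ l)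

  Full-↭ : l ↭ l′ → Full l → Full l′
  Full-↭ p (l! , all) = Unique-↭ p l! , ∈-resp-↭ p ∘ all

  Full-↭-Full : Full l → Full l′ → l ↭ l′
  Full-↭-Full (l! , all) (l′! , all′) = unique⇒↭ l! l′! (λ _ → all′ _) (λ _ → all _)

  root : SearchTree G → Fin n
  root (node r _ _ _ _ _ _) = r

  -- The vertex `r` witnesses that the graph is nonempty; the root of the tree is the first entry of
  -- `l`.
  treeOf : Connected G → Fin n → Full l → Σ (SearchTree G) λ T → Represents T l
  treeOf {l} con r (l! , all) = subst (λ S → Σ (ST G S) λ T → Represents T l) set≡
    (searchTree (length l) l ℕ.≤-refl (subst (ConnectedOn G) (≡.sym set≡) con) (r , set⁺ (all r)) l!)
    where
    set≡ : set l ≡ ⊤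
    set≡ = ⊆-antisym (λ _ → ∈⊤) (λ _ → set⁺ (all _))

  orderOf : Connected G → (T : SearchTree G) → ∃ λ l → Full l × Represents T l
  orderOf con T with removalOrder con T
  ... | l , l! , set≡ , rep = l , (l! , λ v → set⁻ (subst (v ∈_) (≡.sym set≡) ∈⊤)) , rep

  -- Each intermediate order is a permutation of a full one, so it is full itself and represented by
  -- a search tree, at which the rotation paths are joined.
  Path⇒RotPath : ∀ {T U : SearchTree G} {c} → Connected G → Full l → Path l l′ c →
                 Represents T l → Represents U l′ → ∃ λ k → RotPath G T U k × k ≤ c
  Path⇒RotPath con full (same _ f g) repT repU =
    0 , stop (λ X → proj₂ (repU X) ∘ f ∘ proj₁ (repT X) , proj₂ (repT X) ∘ g ∘ proj₁ (repU X)) , z≤n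
  Path⇒RotPath {T = T} {U} con full (flip _ f) repT repU =
    1 , step (Flip⇒Rotation {T = T} {U} repT repU f) (stop λ _ → id , id) , s≤s z≤n
  Path⇒RotPath {T = T} con full (trans p q le) repT repU
    with full′ ← Full-↭ (Path⇒↭ p) full
    with V , repV ← treeOf con (root T) full′
    with j , P , j≤ ← Path⇒RotPath con full p repT repV
       | k , Q , k≤ ← Path⇒RotPath con full′ q repV repU =
    j + k , RotPath-trans P Q , ℕ.≤-trans (ℕ.+-mono-≤ j≤ k≤) le

  -- Both trees are sorted into the same dissection order `l₀`, the second path being traversed
  -- backwards. This is why the cost appears twice.
  diameter : ∀ {p d} → InFamily G p → n < 2 ^ d → DiamLe G (suc p * n * d + suc p * n * d)
  diameter {p} {d} (con , a , b , a≤b , meets , clique) n< T U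
    with lT , fullT , repT ← orderOf con T
       | lU , fullU , repU ← orderOf con U
    with length≡ ← ≡.trans (↭-length (Full-↭-Full fullT (Unique.allFin⁺ n , ∈-allFin)))
                              (length-tabulate id)
    with l₀ , σ , cost ← Intervals.dissection a b a≤b meets clique d lT (proj₁ fullT)
                            (subst (_< 2 ^ d) (≡.sym length≡) n<)
    with cost′ ← subst (λ m → Cost l₀ (suc p * m * d)) length≡ cost =
    Path⇒RotPath con fullT
      (trans (Path-sort cost′ (proj₁ fullT) σ)
             (Path-sym (Path-sort cost′ (proj₁ fullU) (Perm.trans (Full-↭-Full fullU fullT) σ)))
             ℕ.≤-refl)
      repT repU

  -- Reversed edges and the distance between trees

  -- The first vertex removed from the component has the whole component as its tube.
  component-tube : ∀ l → v ∈ₗ l → component (set l) v ∈ₗ tubes l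
  component-tube {v} (w ∷ l) v∈ with w ∈? component (set (w ∷ l)) v
  ... | yes w∈K = here (≡.sym (component-≡ w∈K))
  ... | no  w∉K = there (subst (_∈ₗ tubes l)
    (component-shrink (set-mono there) λ h → case set⁻ (component-⊆ h) of λ where
      (here refl) → contradiction h w∉K
      (there h′)  → set⁺ h′)
    (component-tube l (case v∈ of λ where
      (here refl) → contradiction (component-self (set⁺ (here refl))) w∉K
      (there h)   → h)))

  -- Take the component of `y` right after the removal of `x`. It is closed under edges to vertices
  -- still present, that is, to those after `x`; the last clause records this for the comparison of
  -- two reversed edges.
  separated : ∀ {x y} → Unique l → Precedes x y l →
    ∃ λ X → X ∈ₗ tubes l × y ∈ X × x ∉ X ×
            (∀ {x′ y′} → Precedes x x′ l → y′ ∈ X → Adj x′ y′ → x′ ∈ X)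
  separated {x ∷ l} {x} {y} l! (here y∈l) =
    component (set l) y , there (component-tube l y∈l) , component-self (set⁺ y∈l) ,
    x∉l ∘ set⁻ ∘ component-⊆ ,
    λ where
      (here x′∈l) y′∈ a → component-closed y′∈ (set⁺ x′∈l) (Adj-sym a)
      (there p)         → contradiction (Precedes⇒∈ˡ p) x∉l
    where x∉l = Unique.Unique[x∷xs]⇒x∉xs l!
  separated l!@(_ ∷ l!′) (there q) with separated l!′ q
  ... | X , X∈ , y∈X , x∉X , cl = X , there X∈ , y∈X , x∉X , λ where
    (here _)  → contradiction (Precedes⇒∈ˡ q) (Unique.Unique[x∷xs]⇒x∉xs l!)
    (there p) → cl p

  -- A tube containing `y` is formed no later than the removal of `y`. Then `x` is still present,
  -- and the edge brings it into the same component. Together with `separated`, the tubes thus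
  -- determine the relative order of adjacent vertices.
  not-separated : ∀ {x y} → Unique l → Precedes y x l → Adj x y → X ∈ₗ tubes l → y ∈ X → x ∈ X
  not-separated {z ∷ l} l! p a (here refl) y∈X =
    component-closed y∈X (set⁺ (Precedes⇒∈ʳ p)) (Adj-sym a)
  not-separated {z ∷ l} l! (here _) a (there X∈) y∈X =
    contradiction (set⁻ (tube⊆set X∈ y∈X)) (Unique.Unique[x∷xs]⇒x∉xs l!)
  not-separated {z ∷ l} (_ ∷ l!) (there p) a (there X∈) y∈X = not-separated l! p a X∈ y∈X

  Reversed : List (Fin n) → List (Fin n) → Fin n × Fin n → Set
  Reversed l l′ (x , y) = Adj x y × Precedes x y l × Precedes y x l′

  Reversed-sym : ∀ {x y} → Reversed l l′ (x , y) → Reversed l′ l (y , x)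
  Reversed-sym (a , p , q) = Adj-sym a , q , p

  -- The tubes separating a reversed edge in T and in U are the two tubes
  -- exchanged by the rotation, hence common to all reversed edges.
  reversed-source : ∀ {T U : SearchTree G} → Represents T l → Represents U l′ → Full l → Full l′ →
    Rotation G T U → ∀ {x y x′ y′} → Reversed l l′ (x , y) → Reversed l l′ (x′ , y′) → x ≡ x′
  reversed-source {l} {l′} {T} {U} repT repU (l! , all) (l′! , all′) (A , B , _ , _ , _ , only)
    {x} {y} {x′} {y′} (a , p , q) (a′ , p′ , q′)
    with separated l! p | separated l! p′ | separated l′! q
  ... | X , X∈ , y∈X , x∉X , cl | X′ , X′∈ , y′∈X′ , x′∉X′ , cl′ | Y , Y∈ , x∈Y , y∉Y , _ =
    decide (x ≟ x′)
    where
    old : ∀ {X} → X ∈ₗ tubes l → X ∉ₗ tubes l′ → X ≡ A ⊎ X ≡ B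
    old {X} X∈ X∉ = only X (inj₁ (proj₂ (repT X) X∈ , X∉ ∘ proj₁ (repU X)))
    new : ∀ {X} → X ∈ₗ tubes l′ → X ∉ₗ tubes l → X ≡ A ⊎ X ≡ B
    new {X} X∈ X∉ = only X (inj₂ (proj₂ (repU X) X∈ , X∉ ∘ proj₁ (repT X)))
    -- `Y` is a tube of the second tree only, so it is one of `A` and `B`; tubes of the first tree
    -- only must all be the other one.
    X≡X′ : ∀ {X X′ Y} → X ∈ₗ tubes l → X ∉ₗ tubes l′ → X′ ∈ₗ tubes l → X′ ∉ₗ tubes l′ →
           Y ∈ₗ tubes l′ → Y ∉ₗ tubes l → X ≡ X′
    X≡X′ X∈ X∉ X′∈ X′∉ Y∈ Y∉ with old X∈ X∉ | old X′∈ X′∉ | new Y∈ Y∉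
    ... | inj₁ refl | inj₁ refl | _         = refl
    ... | inj₂ refl | inj₂ refl | _         = refl
    ... | inj₁ refl | inj₂ refl | inj₁ refl = contradiction X∈ Y∉
    ... | inj₁ refl | inj₂ refl | inj₂ refl = contradiction X′∈ Y∉
    ... | inj₂ refl | inj₁ refl | inj₁ refl = contradiction X′∈ Y∉
    ... | inj₂ refl | inj₁ refl | inj₂ refl = contradiction X∈ Y∉
    same-tube : X ≡ X′
    same-tube = X≡X′ X∈ (λ h → x∉X (not-separated l′! q a h y∈X))
                     X′∈ (λ h → x′∉X′ (not-separated l′! q′ a′ h y′∈X′))
                     Y∈ (λ h → y∉Y (not-separated l! p (Adj-sym a) h x∈Y))
    decide : Dec (x ≡ x′) → x ≡ x′
    decide (yes eq)   = eq
    -- If `x` goes first, then `x′` is still present when `X` is formed and is adjacent to `y′` in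
    -- `X`. So `x′` lies in `X`, which equals `X′`, a tube that misses `x′`. The other case is
    -- symmetric.
    decide (no x≢x′) with Precedes-total x≢x′ (all x) (all x′)
    ... | inj₁ xx′ = contradiction
      (subst (x′ ∈_) same-tube (cl xx′ (subst (y′ ∈_) (≡.sym same-tube) y′∈X′) a′)) x′∉X′
    ... | inj₂ x′x = contradiction
      (subst (x ∈_) (≡.sym same-tube) (cl′ x′x (subst (y ∈_) same-tube y∈X) a)) x∉X

  Adj⇒≢ : Adj u v → u ≢ v
  Adj⇒≢ {u} a refl = case ≡.trans (≡.sym a) (irr G u) of λ ()

  reversed-via : ∀ {m e} → Full m → Reversed l l′ e → Reversed m l′ e ⊎ Reversed l m e
  reversed-via {e = x , y} (_ , all) (a , p , q) with Precedes-total (Adj⇒≢ a) (all x) (all y)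
  ... | inj₁ xy = inj₁ (a , xy , q)
  ... | inj₂ yx = inj₂ (a , p , yx)

  -- Equal sets of tubes order all adjacent pairs alike, which settles length zero. Otherwise an
  -- order of the next tree splits the reversed edges: the first rotation accounts for at most one,
  -- the rest of the path for the others.
  reversals≤ : ∀ {T U : SearchTree G} {k} → Connected G → Represents T l → Represents U l′ →
    Full l → Full l′ → RotPath G T U k →
    ∀ {E} → Unique E → All (Reversed l l′) E → length E ≤ k
  reversals≤ con repT repU _ _ _ {[]} _ _ = z≤n
  reversals≤ con repT repU (l! , _) (l′! , _) (stop h) {_ ∷ _} _ ((a , p , q) ∷ _)
    with X , X∈ , y∈X , x∉X , _ ← separated l! p =
    contradiction (not-separated l′! q a (proj₁ (repU X) (proj₁ (h X) (proj₂ (repT X) X∈))) y∈X) x∉X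
  reversals≤ {l} {l′} {T} {U} con repT repU full full′ (step {V = V} r path) {E} E! revs
    with m , fullₘ , repV ← orderOf con V
    with E′ , E′! , revs′ , _ , le ← discard {P = Reversed m l′} {Q = Reversed l m}
      -- First end points agree by `reversed-source`; second ones by applying it to the inverse
      -- rotation and the edges turned around.
      (λ {e} {e′} h h′ → ≡.cong₂ _,_
        (reversed-source {T = T} {V} repT repV full fullₘ r h h′)
        (reversed-source {T = V} {T} repV repT fullₘ full (Rotation-sym {T} {V} r)
          (Reversed-sym h) (Reversed-sym h′)))
      E! (All.map (reversed-via fullₘ) revs) =
    ℕ.≤-trans le (s≤s (reversals≤ con repV repU fullₘ full′ path E′! revs′))

-- The extremal graph: a clique joined to an independent set

does⁻ : ∀ {A : Set} (A? : Dec A) → does A? ≡ true → A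
does⁻ (yes a) _ = a

module SplitGraph (n p : ℕ) where

  vertices : List (Fin n)
  vertices = allFin n

  hubs : List (Fin n)
  hubs = take p vertices

  joined? : ∀ u v → Dec (u ≢ v × (u ∈ₗ hubs ⊎ v ∈ₗ hubs))
  joined? u v = ¬? (u ≟ v) ×-dec ((u ∈ₗ? hubs) ⊎-dec (v ∈ₗ? hubs))

  graph : Graph n
  graph = record
    { adj = λ u v → does (joined? u v)
    ; sym = λ u v → does-⇔ (mk⇔ (flip′ u v) (flip′ v u)) (joined? u v) (joined? v u)
    ; irr = λ v → dec-false (joined? v v) (λ (v≢v , _) → v≢v refl) }
    where
    flip′ : ∀ u v → u ≢ v × (u ∈ₗ hubs ⊎ v ∈ₗ hubs) → v ≢ u × (v ∈ₗ hubs ⊎ u ∈ₗ hubs)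
    flip′ u v (u≢v , h) = u≢v ∘ ≡.sym , swap h

  connected : ∀ {h} → h ∈ₗ hubs → Connected graph
  connected {h} h∈ u v _ _ = walk-trans graph (toHub u) (walk-sym graph (toHub v))
    where
    toHub : ∀ u → Walk graph ⊤ u h
    toHub u with u ≟ h
    ... | yes refl = here ∈⊤
    ... | no  u≢h  = step ∈⊤ (dec-true (joined? u h) (u≢h , inj₂ h∈)) (here ∈⊤)

  start end : Fin n → ℕ
  start v with v ∈ₗ? hubs
  ... | yes _ = 0
  ... | no  _ = toℕ v
  end v with v ∈ₗ? hubs
  ... | yes _ = n
  ... | no  _ = toℕ v

  start≤ : ∀ v → start v ≤ toℕ v
  start≤ v with v ∈ₗ? hubs
  ... | yes _ = z≤n
  ... | no  _ = ℕ.≤-refl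

  ≤end : ∀ v → toℕ v ≤ end v
  ≤end v with v ∈ₗ? hubs
  ... | yes _ = ℕ.<⇒≤ (toℕ<n v)
  ... | no  _ = ℕ.≤-refl

  hub-interval : ∀ {h} → h ∈ₗ hubs → ∀ (v : Fin n) → start h ≤ toℕ v × toℕ v ≤ end h
  hub-interval {h} h∈ v with h ∈ₗ? hubs
  ... | yes _  = z≤n , ℕ.<⇒≤ (toℕ<n v)
  ... | no  h∉ = contradiction h∈ h∉

  leaf-overlap : ∀ {u v} → u ∉ₗ hubs → v ∉ₗ hubs → Overlap graph start end u v → u ≡ v
  leaf-overlap {u} {v} u∉ v∉ h with u ∈ₗ? hubs | v ∈ₗ? hubs
  ... | yes u∈ | _      = contradiction u∈ u∉
  ... | no _   | yes v∈ = contradiction v∈ v∉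
  leaf-overlap u∉ v∉ (x , (u≤x , x≤u) , (v≤x , x≤v)) | no _ | no _ =
    toℕ-injective (≡.trans (ℕ.≤-antisym u≤x x≤u) (ℕ.≤-antisym x≤v v≤x))

  hubs≤ : length hubs ≤ p
  hubs≤ = ℕ.≤-trans (ℕ.≤-reflexive (length-take p vertices)) (ℕ.m⊓n≤m p _)

  -- Hubs receive the whole range and the other vertices distinct single points. A clique thus has
  -- at most one vertex besides the at most `p` hubs.
  pathwidth≤ : PathwidthLe graph p
  pathwidth≤ = start , end , (λ v → ℕ.≤-trans (start≤ v) (≤end v)) , meets , clique
    where
    meets : ∀ u v → adj graph u v ≡ true → Overlap graph start end u v
    meets u v a with does⁻ (joined? u v) a
    ... | _ , inj₁ u∈ = toℕ v , hub-interval u∈ v , start≤ v , ≤end v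
    ... | _ , inj₂ v∈ = toℕ u , (start≤ u , ≤end u) , hub-interval v∈ u
    clique : ∀ K → (∀ u v → u ∈ K → v ∈ K → u ≢ v → Overlap graph start end u v) → ∣ K ∣ ≤ suc p
    clique K overlaps with any? (λ v → (v ∈? K) ×-dec ¬? (v ∈ₗ? hubs))
    ... | yes (v , v∈K , v∉) = ℕ.≤-trans (⊆⇒∣∣≤length (v ∷ hubs) cover) (s≤s hubs≤)
      where
      cover : ∀ {u} → u ∈ K → u ∈ₗ v ∷ hubs
      cover {u} u∈K with u ≟ v | u ∈ₗ? hubs
      ... | yes u≡v | _      = here u≡v
      ... | no  _   | yes u∈ = there u∈
      ... | no  u≢v | no u∉  = contradiction (leaf-overlap u∉ v∉ (overlaps u v u∈K v∈K u≢v)) u≢v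
    ... | no all-hubs = ℕ.≤-trans (⊆⇒∣∣≤length hubs cover) (ℕ.≤-trans hubs≤ (ℕ.n≤1+n p))
      where
      cover : ∀ {u} → u ∈ K → u ∈ₗ hubs
      cover {u} u∈K with u ∈ₗ? hubs
      ... | yes u∈ = u∈
      ... | no  u∉ = contradiction (u , u∈K , u∉) all-hubs

  vertices-full : Full graph vertices
  vertices-full = Unique.allFin⁺ n , ∈-allFin

  reverse-full : Full graph (reverse vertices)
  reverse-full = Full-↭ graph (↭-sym (↭-reverse vertices)) vertices-full

  edges-reversed : All (Reversed graph vertices (reverse vertices)) (pairs p vertices)
  edges-reversed = All.tabulate λ {(x , y)} h →
    let q = pairs⇒Precedes p h in
    dec-true (joined? x y) (Precedes⇒≢ (proj₁ vertices-full) q , inj₁ (pairs⇒take p h)) ,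
    q , Precedes-reverse q

  -- By `length-pairs`, twice the number of edges is 2 p n - p (p + 1), and p + 1 is at most n.
  -- Adding `p * n` to both sides avoids the subtraction.
  edges-bound : p < n → p * n ≤ 2 * length (pairs p vertices)
  edges-bound p<n = ℕ.+-cancelʳ-≤ (p * n) _ _ (begin
    p * n + p * n                                 ≡⟨ cong (p * n +_) (≡.sym (ℕ.+-identityʳ (p * n))) ⟩
    2 * (p * n)                                   ≡⟨ cong (λ m → 2 * (p * m)) (≡.sym length≡) ⟩
    2 * (p * length vertices)                     ≡⟨ ≡.sym (length-pairs p vertices
                                                       (subst (p ≤_) (≡.sym length≡) (ℕ.<⇒≤ p<n))) ⟩
    2 * length (pairs p vertices) + p * suc p     ≤⟨ ℕ.+-monoʳ-≤ _ (ℕ.*-monoʳ-≤ p p<n) ⟩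
    2 * length (pairs p vertices) + p * n         ∎)
    where
    open ℕ.≤-Reasoning
    length≡ : length vertices ≡ n
    length≡ = length-tabulate id

  distant-trees : ∀ {h} → h ∈ₗ hubs → p < n →
    ∃ λ (T : SearchTree graph) → ∃ λ (U : SearchTree graph) →
      ∀ k → RotPath graph T U k → p * n ≤ 2 * k
  distant-trees {h} h∈ p<n
    with T , repT ← treeOf graph (connected h∈) h vertices-full
       | U , repU ← treeOf graph (connected h∈) h reverse-full =
    T , U , λ k path → ℕ.≤-trans (edges-bound p<n) (ℕ.*-monoʳ-≤ 2
      (reversals≤ graph (connected h∈) repT repU vertices-full reverse-full path
        (pairs-unique p (proj₁ vertices-full)) edges-reversed))

lower-bound : ∀ n p → 1 ≤ p → p < n → ∃ λ (G : Graph n) → InFamily G p ×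
  ∃ λ (T : SearchTree G) → ∃ λ (U : SearchTree G) → ∀ k → RotPath G T U k → p * n ≤ 2 * k
lower-bound (suc n) (suc p) _ p<n =
  -- Both parameters are successors, so vertex 0 is the first hub.
  graph , (connected (here refl) , pathwidth≤) , distant-trees (here refl) p<n
  where open SplitGraph (suc n) (suc p)

-- Constants and the asymptotic bounds

n<2^[1+⌊log₂n⌋] : ∀ n → n < 2 ^ suc ⌊log₂ n ⌋
n<2^[1+⌊log₂n⌋] n = ℕ.≰⇒> λ h → ℕ.<-irrefl refl
  (subst (_≤ ⌊log₂ n ⌋) (⌊log₂[2^n]⌋≡n (suc ⌊log₂ n ⌋)) (⌊log₂⌋-mono-≤ h))

-- The factor 8 combines the two sorted trees with p + 1 at most 2 p and L + 1 at most 2 L.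
double-cost≤ : ∀ {p n L} → 1 ≤ p → 1 ≤ L →
               suc p * n * suc L + suc p * n * suc L ≤ 8 * p * n * L
double-cost≤ {p} {n} {L} 1≤p 1≤L = ℕ.≤-trans (ℕ.+-mono-≤ half half) (ℕ.≤-reflexive
  (solve 3 (λ p n L → (p :+ p) :* n :* (L :+ L) :+ (p :+ p) :* n :* (L :+ L) :=
                      κ 8 :* p :* n :* L) refl p n L))
  where
  half : suc p * n * suc L ≤ (p + p) * n * (L + L)
  half = ℕ.*-mono-≤ (ℕ.*-monoˡ-≤ n (ℕ.+-monoˡ-≤ p 1≤p)) (ℕ.+-monoˡ-≤ L 1≤L)

DiamLe-mono : ∀ {n a b} {G : Graph n} → a ≤ b → DiamLe G a → DiamLe G b
DiamLe-mono a≤b diam T U with diam T U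
... | k , path , k≤a = k , path , ℕ.≤-trans k≤a a≤b

upper-bound : ∀ {n p} (G : Graph n) → 2 ≤ n → 1 ≤ p → InFamily G p →
              DiamLe G (8 * p * n * ⌊log₂ n ⌋)
upper-bound {n} {p} G 2≤n 1≤p fam = DiamLe-mono {G = G}
  (double-cost≤ {p} {n} {⌊log₂ n ⌋} 1≤p (⌊log₂⌋-mono-≤ 2≤n))
  (diameter G fam (n<2^[1+⌊log₂n⌋] n))

-- The range of `pw` covers the meaningful values: for n at least 2, a connected graph has pathwidth
-- at least 1, and any graph on n vertices has pathwidth at most n - 1.
theorem6 : (pw : ℕ → ℕ) → (∀ n → 2 ≤ n → 1 ≤ pw n × pw n < n) →
    (∃ λ d → ∃ λ N → 1 ≤ d × (∀ n → N ≤ n →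
    ∃ λ (G : Graph n) → InFamily G (pw n) ×
    ∃ λ (T : SearchTree G) → ∃ λ (U : SearchTree G) →
    ∀ k → RotPath G T U k → pw n * n ≤ d * k))
    ×
    (∃ λ C → ∃ λ N → ∀ n → N ≤ n →
    ∀ (G : Graph n) → InFamily G (pw n) →
    DiamLe G (C * pw n * n * ⌊log₂ n ⌋))
theorem6 pw range =
  -- The constant `d = 2` is the factor in `edges-bound`.
  (2 , 2 , s≤s z≤n , λ n 2≤n → lower-bound n (pw n) (proj₁ (range n 2≤n)) (proj₂ (range n 2≤n))) ,
  -- The threshold 2 makes the logarithm at least 1, as `double-cost≤` requires.
  (8 , 2 , λ n 2≤n G → upper-bound G 2≤n (proj₁ (range n 2≤n)))
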